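{- Let $n\ge 1$ and let $\overrightarrow{G}=([n],E)$ be any directed graph with vertex set $[n]=\{1,\dots,n\}$, and let $G$ be its underlying undirected graph. Then $$\omega X_{\overrightarrow{G}}(\mathbf{x},t)=\sum_{\sigma\in\mathfrak{S}_n}F_{n,\mathrm{DES}_G(\sigma)}(\mathbf{x})\,t^{\mathrm{inv}_{\overrightarrow{G}}(\sigma)}.$$
   Context: Digraphs are simple (no loops, no repeated directed edges); $(i,j)\in E$ is an edge directed from $i$ to $j$. The underlying undirected graph $G$ has an edge $\{i,j\}$ iff $(i,j)\in E$ or $(j,i)\in E$. A proper coloring of $\overrightarrow{G}$ is a map $\kappa:V\to\mathbb{P}=\{1,2,3,\dots\}$ with $\kappa(u)\ne\kappa(v)$ whenever $u,v$ are adjacent. Its ascent number is $\mathrm{asc}(\kappa)=|\{(u,v)\in E:\kappa(u)<\kappa(v)\}|$. The chromatic quasisymmetric function is $$X_{\overrightarrow{G}}(\mathbf{x},t)=\sum_{\kappa}t^{\mathrm{asc}(\kappa)}\prod_{v\in V}x_{\kappa(v)},$$ the sum over all proper colorings $\kappa$; it is a polynomial in $t$ with coefficients in the ring $\mathrm{QSym}_{\mathbb{Q}}$ of quasisymmetric functions in $x_1,x_2,\dots$. For $S\subseteq[n-1]$, Gessel's fundamental quasisymmetric function is $F_{n,S}(\mathbf{x})=\sum x_{i_1}x_{i_2}\cdots x_{i_n}$, summed over $i_1\ge i_2\ge\cdots\ge i_n\ge1$ with $i_j>i_{j+1}$ for all $j\in S$. The map $\omega$ is the linear involution on $\mathrm{QSym}_{\mathbb{Q}}$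 with $\omega(F_{n,S})=F_{n,[n-1]\setminus S}$ (it restricts to the usual involution $\omega$ on symmetric functions), extended to $\mathrm{QSym}_{\mathbb{Q}}[t]$ coefficientwise in $t$. For $\sigma=\sigma_1\cdots\sigma_n\in\mathfrak{S}_n$: $\mathrm{inv}_{\overrightarrow{G}}(\sigma)=|\{(i,j)\in E:\sigma^{ -1}(j)<\sigma^{ -1}(i)\}|$, i.e. the number of directed edges $i\to j$ such that $j$ appears before $i$ in $\sigma$. For $x\in[n]$, $\mathrm{rank}_{(G,\sigma)}(x)$ is the length $k$ of the longest subword $\sigma_{i_1}\sigma_{i_2}\cdots\sigma_{i_k}$ with $i_1<\cdots<i_k$, $\sigma_{i_k}=x$, and $\{\sigma_{i_j},\sigma_{i_{j+1}}\}$ an edge of $G$ for each $1\le j<k$. For $1\le i\le n-1$, $\sigma$ has a $G$-descent at $i$ if either $\mathrm{rank}_{(G,\sigma)}(\sigma_i)>\mathrm{rank}_{(G,\sigma)}(\sigma_{i+1})$, or these ranks are equal and $\sigma_i>\sigma_{i+1}$. $\mathrm{DES}_G(\sigma)$ is the set of $G$-descents of $\sigma$. -}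

module Defs where

open import Algebra.Bundles using (CommutativeSemigroup)
open import Algebra.Module.Bundles using (LeftModule)
import Algebra.Module.Morphism.Structures as ModuleMorphisms
import Algebra.Properties.CommutativeSemigroup as CommutativeSemigroup
open import Algebra.Structures using (IsCommutativeMonoid)
open import Data.Bool.Base using (Bool; true; false; if_then_else_; not)
open import Data.Fin.Base as Fin using (Fin; zero; suc; inject₁; fromℕ)
import Data.Fin.Properties as Fin
open import Data.Fin.Subset using (Subset; _∈_; _⊆_; ∁)
open import Data.Fin.Subset.Properties using (_∈?_; _⊆?_)
import Data.Fin.Subset.Properties as Subset
import Data.Integer.Base as ℤ
import Data.Integer.Properties as ℤ
open import Data.List.Base as List using (List; []; _∷_; _++_; length; filter; allFin; cartesianProduct; cartesianProductWith; foldr)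
open import Data.List.Extrema.Nat using (max)
import Data.List.Membership.Propositional as ∈List
import Data.List.Membership.Propositional.Properties as ∈List
open import Data.List.Membership.Propositional.Properties.WithK using (unique∧set⇒bag)
import Data.List.Properties as List
open import Data.List.Relation.Binary.BagAndSetEquality using (∼bag⇒↭)
open import Data.List.Relation.Binary.Permutation.Propositional.Properties using (↭-length)
open import Data.List.Relation.Unary.All using ([])
import Data.List.Relation.Unary.AllPairs as AllPairs
open import Data.List.Relation.Unary.Any using (here; there)
open import Data.List.Relation.Unary.Linked using (Linked; linked?)
import Data.List.Relation.Unary.Unique.DecPropositional as DecUnique
open import Data.List.Relation.Unary.Unique.Propositional using (Unique)
import Data.List.Relation.Unary.Unique.Propositional.Properties as Unique
open import Data.Maybe.Base using (just)
import Data.Maybe.Properties as Maybe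
open import Data.Nat.Base as ℕ using (ℕ; zero; suc; pred; _≤_; _<_; _>_)
import Data.Nat.Coprimality as Coprime
open import Data.Nat.ListAction using (sum)
import Data.Nat.Properties as ℕ
open import Data.Product.Base using (∃; ∃₂; _×_; _,_; proj₁; proj₂; uncurry)
open import Data.Rational.Base as ℚ using (ℚ; 0ℚ; 1ℚ)
import Data.Rational.Properties as ℚ
open import Data.Sum.Base using (_⊎_; inj₁; inj₂)
open import Data.Vec.Base as Vec using (Vec; []; _∷_; lookup)
import Data.Vec.Properties as Vec
open import Function.Base using (_∘_; id; case_of_)
open import Function.Bundles using (_⇔_; mk⇔; Equivalence)
open import Function.Construct.Symmetry using (⇔-sym)
open import Level using (0ℓ)
open import Relation.Binary.Core using (Rel)
open import Relation.Binary.Definitions using (Decidable; Irreflexive; tri<; tri≈; tri>)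
open import Relation.Binary.PropositionalEquality hiding ([_])
open import Relation.Nullary using (¬_; Dec; yes; no; does; contradiction)
open import Relation.Nullary.Decidable using (does-⇔; _×-dec_; _⊎-dec_; _→-dec_; ¬?; dec-true; dec-false)
import Relation.Unary as U

Word : ℕ → ℕ → Set
Word N n = Vec (Fin N) n

words : ∀ N n → List (Word N n)
words N zero    = [] ∷ []
words N (suc n) = cartesianProductWith _∷_ (allFin N) (words N n)

-- The positions j and j + 1, for j ∈ [n-1].

pos : ∀ {n} → Fin (pred n) → Fin n
pos {suc n} = inject₁

next : ∀ {n} → Fin (pred n) → Fin n
next {suc n} = suc

-- The monomial x₁^a₁ x₂^a₂ ⋯ x_N^a_N.  Lists differing by trailing
-- zeros denote the same monomial.

Monomial : Set
Monomial = List ℕ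

nonzero : List ℕ → List ℕ
nonzero = filter (λ k → ¬? (k ℕ.≟ 0))

-- A formal power series of bounded degree in which the coefficient of
-- x_{i₁}^a₁ ⋯ x_{iₖ}^aₖ, for i₁ < ⋯ < iₖ and all aⱼ ≥ 1, depends only
-- on (a₁, …, aₖ).

record QSym : Set where
  field
    coeff   : Monomial → ℚ
    quasi   : ∀ a b → nonzero a ≡ nonzero b → coeff a ≡ coeff b
    bounded : ∃ λ d → ∀ a → d < sum a → coeff a ≡ 0ℚ

open QSym public

infix 4 _≈Q_

record _≈Q_ (f g : QSym) : Set where
  constructor mk≈
  field
    coeff-≡ : ∀ a → coeff f a ≡ coeff g a

open _≈Q_ public

infixl 6 _+Q_
infixr 7 _·Q_
infix  8 -Q_

0Q : QSym
0Q = record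
  { coeff   = λ _ → 0ℚ
  ; quasi   = λ _ _ _ → refl
  ; bounded = 0 , λ _ _ → refl
  }

_+Q_ : QSym → QSym → QSym
f +Q g = record
  { coeff   = λ a → coeff f a ℚ.+ coeff g a
  ; quasi   = λ a b eq → cong₂ ℚ._+_ (quasi f a b eq) (quasi g a b eq)
  ; bounded = let (d , p) = bounded f ; (e , q) = bounded g in
      d ℕ.⊔ e , λ a lt → cong₂ ℚ._+_
        (p a (ℕ.≤-<-trans (ℕ.m≤m⊔n d e) lt))
        (q a (ℕ.≤-<-trans (ℕ.m≤n⊔m d e) lt))
  }

_·Q_ : ℚ → QSym → QSym
c ·Q f = record
  { coeff   = λ a → c ℚ.* coeff f a
  ; quasi   = λ a b eq → cong (c ℚ.*_) (quasi f a b eq)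
  ; bounded = let (d , p) = bounded f in
      d , λ a lt → trans (cong (c ℚ.*_) (p a lt)) (ℚ.*-zeroʳ c)
  }

-Q_ : QSym → QSym
-Q f = record
  { coeff   = λ a → ℚ.- coeff f a
  ; quasi   = λ a b eq → cong ℚ.-_ (quasi f a b eq)
  ; bounded = let (d , p) = bounded f in
      d , λ a lt → cong ℚ.-_ (p a lt)
  }

QSym-leftModule : LeftModule ℚ.+-*-ring 0ℓ 0ℓ
QSym-leftModule = record
  { Carrierᴹ = QSym
  ; _≈ᴹ_ = _≈Q_
  ; _+ᴹ_ = _+Q_
  ; _*ₗ_ = _·Q_
  ; 0ᴹ   = 0Q
  ; -ᴹ_  = -Q_
  ; isLeftModule = record
    { isLeftSemimodule = record
      { +ᴹ-isCommutativeMonoid = record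
        { isMonoid = record
          { isSemigroup = record
            { isMagma = record
              { isEquivalence = record
                { refl  = mk≈ λ _ → refl
                ; sym   = λ p → mk≈ λ a → sym (coeff-≡ p a)
                ; trans = λ p q → mk≈ λ a → trans (coeff-≡ p a) (coeff-≡ q a)
                }
              ; ∙-cong = λ p q → mk≈ λ a → cong₂ ℚ._+_ (coeff-≡ p a) (coeff-≡ q a)
              }
            ; assoc = λ f g h → mk≈ λ a → ℚ.+-assoc (coeff f a) (coeff g a) (coeff h a)
            }
          ; identity = (λ f → mk≈ λ a → ℚ.+-identityˡ (coeff f a))
                     , (λ f → mk≈ λ a → ℚ.+-identityʳ (coeff f a))
          }
        ; comm = λ f g → mk≈ λ a → ℚ.+-comm (coeff f a) (coeff g a)
        }
      ; isPreleftSemimodule = record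
        { *ₗ-cong      = λ p q → mk≈ λ a → cong₂ ℚ._*_ p (coeff-≡ q a)
        ; *ₗ-zeroˡ     = λ f → mk≈ λ a → ℚ.*-zeroˡ (coeff f a)
        ; *ₗ-distribʳ  = λ f x y → mk≈ λ a → ℚ.*-distribʳ-+ (coeff f a) x y
        ; *ₗ-identityˡ = λ f → mk≈ λ a → ℚ.*-identityˡ (coeff f a)
        ; *ₗ-assoc     = λ x y f → mk≈ λ a → ℚ.*-assoc x y (coeff f a)
        ; *ₗ-zeroʳ     = λ x → mk≈ λ a → ℚ.*-zeroʳ x
        ; *ₗ-distribˡ  = λ x f g → mk≈ λ a → ℚ.*-distribˡ-+ x (coeff f a) (coeff g a)
        }
      }
    ; -ᴹ‿cong    = λ p → mk≈ λ a → cong ℚ.-_ (coeff-≡ p a)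
    ; -ᴹ‿inverse = (λ f → mk≈ λ a → ℚ.+-inverseˡ (coeff f a))
                 , (λ f → mk≈ λ a → ℚ.+-inverseʳ (coeff f a))
    }
  }

open LeftModule QSym-leftModule using (rawLeftModule)
open ModuleMorphisms.LeftModuleMorphisms rawLeftModule rawLeftModule public
  using (IsLeftModuleHomomorphism)

-- The number of occurrences of each letter, so that
-- x_{w₁} x_{w₂} ⋯ x_{wₙ} is the monomial with exponents content w.

occ : ∀ {N n} → Fin N → Word N n → ℕ
occ c = Vec.count (c Fin.≟_)

content : ∀ {N n} → Word N n → Monomial
content w = List.tabulate λ c → occ c w

StrictlyMonotone : ∀ {M N} → (Fin M → Fin N) → Set
StrictlyMonotone ι = ∀ {i j} → i Fin.< j → ι i Fin.< ι j

-- A condition on maps [n] → ℙ that only depends on the relative order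
-- of their values.

record OrderInvariant (n : ℕ) : Set₁ where
  field
    Holds     : ∀ {N} → Word N n → Set
    holds?    : ∀ {N} → U.Decidable (Holds {N})
    invariant : ∀ {M N} (ι : Fin M → Fin N) → StrictlyMonotone ι →
                ∀ w → Holds w ⇔ Holds (Vec.map ι w)

open OrderInvariant public

fromℕℚ : ℕ → ℚ
fromℕℚ k = ℤ.+ k ℚ./ 1

-- The coefficient of x^a in the sum of x_{w₁} ⋯ x_{wₙ} over all maps
-- w : [n] → ℙ satisfying P.  Only the first length a variables occur in
-- x^a, so only the maps into [length a] can contribute.

WithContent : ∀ {n} → OrderInvariant n → (a : Monomial) → Word (length a) n → Set
WithContent P a w = content w ≡ a × Holds P w

withContent? : ∀ {n} (P : OrderInvariant n) a → U.Decidable (WithContent P a)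
withContent? P a w = List.≡-dec ℕ._≟_ (content w) a ×-dec holds? P w

genCoeff : ∀ {n} → OrderInvariant n → Monomial → ℚ
genCoeff {n} P a = fromℕℚ (length (filter (withContent? P a) (words (length a) n)))

words-unique : ∀ N n → Unique (words N n)
words-unique N zero    = [] AllPairs.∷ AllPairs.[]
words-unique N (suc n) = Unique.cartesianProductWith⁺ _∷_ (λ { refl → refl , refl })
  (Unique.allFin⁺ N) (words-unique N n)

words-complete : ∀ {N n} (w : Word N n) → w ∈List.∈ words N n
words-complete []      = here refl
words-complete (x ∷ w) = ∈List.∈-cartesianProductWith⁺ _∷_ (∈List.∈-allFin x) (words-complete w)

same-length : ∀ {A : Set} {xs ys : List A} → Unique xs → Unique ys →
              (∀ {x} → x ∈List.∈ xs ⇔ x ∈List.∈ ys) → length xs ≡ length ys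
same-length ux uy eq = ↭-length (∼bag⇒↭ (unique∧set⇒bag ux uy eq))

count-bij : ∀ {M N n} {P : U.Pred (Word M n) 0ℓ} {Q : U.Pred (Word N n) 0ℓ}
  (P? : U.Decidable P) (Q? : U.Decidable Q) (f : Word M n → Word N n) →
  (∀ {v w} → f v ≡ f w → v ≡ w) → (∀ {w} → P w → Q (f w)) →
  (∀ {v} → Q v → ∃ λ w → P w × v ≡ f w) →
  length (filter P? (words M n)) ≡ length (filter Q? (words N n))
count-bij {M} {N} {n} {Q = Q} P? Q? f inj to from = trans
  (sym (List.length-map f (filter P? (words M n))))
  (same-length (Unique.map⁺ inj (Unique.filter⁺ P? (words-unique M n)))
               (Unique.filter⁺ Q? (words-unique N n))
    (mk⇔ (λ v∈ → let (w , w∈ , eq) = ∈List.∈-map⁻ f v∈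
                     (_ , p) = ∈List.∈-filter⁻ P? {xs = words M n} w∈ in
                  ∈List.∈-filter⁺ Q? (words-complete _) (subst Q (sym eq) (to p)))
         (λ v∈ → let (_ , q) = ∈List.∈-filter⁻ Q? {xs = words N n} v∈
                     (w , p , eq) = from q in
                  subst (λ v → v ∈List.∈ List.map f (filter P? (words M n))) (sym eq)
                    (∈List.∈-map⁺ f (∈List.∈-filter⁺ P? (words-complete w) p)))))

tabulate-inj : ∀ {A : Set} {n} {f g : Fin n → A} → List.tabulate f ≡ List.tabulate g → f ≗ g
tabulate-inj {n = suc n} eq zero    = List.∷-injectiveˡ eq
tabulate-inj {n = suc n} eq (suc i) = tabulate-inj (List.∷-injectiveʳ eq) i

content⇒occ : ∀ a {n} (w : Word (length a) n) → content w ≡ a → ∀ c → occ c w ≡ List.lookup a c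
content⇒occ a w eq = tabulate-inj (trans eq (sym (List.tabulate-lookup a)))

occ⇒content : ∀ a {n} (w : Word (length a) n) → (∀ c → occ c w ≡ List.lookup a c) → content w ≡ a
occ⇒content a w eq = trans (List.tabulate-cong eq) (List.tabulate-lookup a)

embed : ∀ a → Fin (length (nonzero a)) → Fin (length a)
embed (zero ∷ a)  c       = suc (embed a c)
embed (suc k ∷ a) zero    = zero
embed (suc k ∷ a) (suc c) = suc (embed a c)

embed-mono : ∀ a → StrictlyMonotone (embed a)
embed-mono (zero ∷ a)  lt = ℕ.s<s (embed-mono a lt)
embed-mono (suc k ∷ a) {zero}  {suc j} lt = ℕ.z<s
embed-mono (suc k ∷ a) {suc i} {suc j} (ℕ.s<s lt) = ℕ.s<s (embed-mono a lt)

lookup-embed : ∀ a c → List.lookup a (embed a c) ≡ List.lookup (nonzero a) c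
lookup-embed (zero ∷ a)  c       = lookup-embed a c
lookup-embed (suc k ∷ a) zero    = refl
lookup-embed (suc k ∷ a) (suc c) = lookup-embed a c

embed-view : ∀ a c → (∃ λ d → c ≡ embed a d) ⊎ (List.lookup a c ≡ 0 × ∀ d → c ≢ embed a d)
embed-view (zero ∷ a)  zero    = inj₂ (refl , λ _ ())
embed-view (zero ∷ a)  (suc c) with embed-view a c
... | inj₁ (d , refl) = inj₁ (d , refl)
... | inj₂ (z , ne)   = inj₂ (z , λ d eq → ne d (Fin.suc-injective eq))
embed-view (suc k ∷ a) zero    = inj₁ (zero , refl)
embed-view (suc k ∷ a) (suc c) with embed-view a c
... | inj₁ (d , refl) = inj₁ (suc d , refl)
... | inj₂ (z , ne)   = inj₂ (z , λ { zero () ; (suc d) eq → ne d (Fin.suc-injective eq) })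

mono-injective : ∀ {M N} {ι : Fin M → Fin N} → StrictlyMonotone ι → ∀ {i j} → ι i ≡ ι j → i ≡ j
mono-injective mono {i} {j} eq with Fin.<-cmp i j
... | tri< lt _ _ = contradiction eq (Fin.<⇒≢ (mono lt))
... | tri≈ _ e _  = e
... | tri> _ _ gt = contradiction (sym eq) (Fin.<⇒≢ (mono gt))

mono-reflects : ∀ {M N} {ι : Fin M → Fin N} → StrictlyMonotone ι → ∀ {i j} → ι i Fin.< ι j → i Fin.< j
mono-reflects mono {i} {j} lt with Fin.<-cmp i j
... | tri< l _ _    = l
... | tri≈ _ refl _ = contradiction lt (Fin.<-irrefl refl)
... | tri> _ _ gt   = contradiction (mono gt) (Fin.<-asym lt)

occ-map : ∀ {M N n} (ι : Fin M → Fin N) → StrictlyMonotone ι →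
          ∀ c (w : Word M n) → occ (ι c) (Vec.map ι w) ≡ occ c w
occ-map ι mono c []      = refl
occ-map ι mono c (x ∷ w) with c Fin.≟ x | ι c Fin.≟ ι x
... | yes _    | yes _ = cong suc (occ-map ι mono c w)
... | no  _    | no  _ = occ-map ι mono c w
... | yes refl | no ne = contradiction refl ne
... | no ne    | yes e = contradiction (mono-injective mono e) ne

occ-map-0 : ∀ {M N n} (ι : Fin M → Fin N) c → (∀ d → c ≢ ι d) →
            ∀ (w : Word M n) → occ c (Vec.map ι w) ≡ 0
occ-map-0 ι c ne []      = refl
occ-map-0 ι c ne (x ∷ w) with c Fin.≟ ι x
... | yes e = contradiction e (ne x)
... | no  _ = occ-map-0 ι c ne w

occ>0 : ∀ {N n} (w : Word N n) i → 0 < occ (lookup w i) w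
occ>0 (x ∷ w) zero with x Fin.≟ x
... | yes _ = ℕ.z<s
... | no ne = contradiction refl ne
occ>0 (x ∷ w) (suc i) with lookup w i Fin.≟ x
... | yes _ = ℕ.z<s
... | no _  = occ>0 w i

map-injective : ∀ {A B : Set} {n} {f : A → B} → (∀ {x y} → f x ≡ f y → x ≡ y) →
                ∀ {v w : Vec A n} → Vec.map f v ≡ Vec.map f w → v ≡ w
map-injective inj {[]}    {[]}    eq = refl
map-injective inj {x ∷ v} {y ∷ w} eq =
  cong₂ _∷_ (inj (Vec.∷-injectiveˡ eq)) (map-injective inj (Vec.∷-injectiveʳ eq))

lift-word : ∀ {M N n} (ι : Fin M → Fin N) (w : Word N n) →
            (∀ i → ∃ λ d → lookup w i ≡ ι d) → ∃ λ v → w ≡ Vec.map ι v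
lift-word ι []      p = [] , refl
lift-word ι (x ∷ w) p with p zero | lift-word ι w (p ∘ suc)
... | d , refl | v , refl = d ∷ v , refl

genCoeff-nonzero : ∀ {n} (P : OrderInvariant n) a → genCoeff P (nonzero a) ≡ genCoeff P a
genCoeff-nonzero {n} P a = cong fromℕℚ
  (count-bij (withContent? P (nonzero a)) (withContent? P a) (Vec.map ι)
    (map-injective (mono-injective mono)) to from)
  where
  ι = embed a
  mono : StrictlyMonotone ι
  mono = embed-mono a

  to : ∀ {w} → WithContent P (nonzero a) w → WithContent P a (Vec.map ι w)
  to {w} (eq , h) = occ⇒content a (Vec.map ι w) go , Equivalence.to (invariant P ι mono w) h
    where
    go : ∀ c → occ c (Vec.map ι w) ≡ List.lookup a c
    go c with embed-view a c
    ... | inj₁ (d , refl) = trans (occ-map ι mono d w)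
            (trans (content⇒occ (nonzero a) w eq d) (sym (lookup-embed a d)))
    ... | inj₂ (z , ne) = trans (occ-map-0 ι c ne w) (sym z)

  from : ∀ {v} → WithContent P a v → ∃ λ w → WithContent P (nonzero a) w × v ≡ Vec.map ι w
  from {v} (eq , h) = let (w , e) = lift-word ι v letters in w , go w e , e
    where
    letters : ∀ i → ∃ λ d → lookup v i ≡ ι d
    letters i with embed-view a (lookup v i)
    ... | inj₁ p       = p
    ... | inj₂ (z , _) = contradiction (occ>0 v i)
            (ℕ.<-irrefl (sym (trans (content⇒occ a v eq (lookup v i)) z)))
    go : ∀ w → v ≡ Vec.map ι w → WithContent P (nonzero a) w
    go w refl = occ⇒content (nonzero a) w (λ d → trans (sym (occ-map ι mono d w))
                  (trans (content⇒occ a v eq (ι d)) (lookup-embed a d)))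
              , Equivalence.from (invariant P ι mono w) h

sum-suc : ∀ {N} (f g : Fin N → ℕ) x → f x ≡ suc (g x) → (∀ c → c ≢ x → f c ≡ g c) →
          sum (List.tabulate f) ≡ suc (sum (List.tabulate g))
sum-suc f g zero    eq ne = cong₂ ℕ._+_ eq
  (cong sum (List.tabulate-cong (λ c → ne (suc c) λ ())))
sum-suc f g (suc x) eq ne = trans
  (cong₂ ℕ._+_ (ne zero λ ()) (sum-suc (f ∘ suc) (g ∘ suc) x eq
    (λ c p → ne (suc c) (p ∘ Fin.suc-injective))))
  (ℕ.+-suc (g zero) _)

sum-zero : ∀ N → sum (List.tabulate {n = N} (λ _ → 0)) ≡ 0
sum-zero zero    = refl
sum-zero (suc N) = sum-zero N

sum-content : ∀ {N n} (w : Word N n) → sum (content w) ≡ n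
sum-content {N} [] = sum-zero N
sum-content {N} (x ∷ w) = trans
  (sum-suc (λ c → occ c (x ∷ w)) (λ c → occ c w) x eq ne) (cong suc (sum-content w))
  where
  eq : occ x (x ∷ w) ≡ suc (occ x w)
  eq with x Fin.≟ x
  ... | yes _ = refl
  ... | no ne = contradiction refl ne
  ne : ∀ c → c ≢ x → occ c (x ∷ w) ≡ occ c w
  ne c c≢x with c Fin.≟ x
  ... | yes e = contradiction e c≢x
  ... | no _  = refl

filter-empty : ∀ {A : Set} {P : U.Pred A 0ℓ} (P? : U.Decidable P) → (∀ x → ¬ P x) →
               ∀ xs → length (filter P? xs) ≡ 0
filter-empty P? np xs = cong length (List.filter-none P? (All.universal np xs))
  where import Data.List.Relation.Unary.All as All

genCoeff-degree : ∀ {n} (P : OrderInvariant n) a → sum a ≢ n → genCoeff P a ≡ 0ℚ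
genCoeff-degree {n} P a ne = cong fromℕℚ (filter-empty (withContent? P a)
  (λ w (eq , _) → ne (trans (cong sum (sym eq)) (sum-content w))) (words (length a) n))

-- The sum of x_{w₁} x_{w₂} ⋯ x_{wₙ} over all maps w : [n] → ℙ
-- satisfying P.

gen : ∀ {n} → OrderInvariant n → QSym
gen {n} P = record
  { coeff   = genCoeff P
  ; quasi   = λ a b eq → trans (sym (genCoeff-nonzero P a))
                (trans (cong (genCoeff P) eq) (genCoeff-nonzero P b))
  ; bounded = n , λ a lt → genCoeff-degree P a (λ eq → ℕ.<⇒≢ lt (sym eq))
  }

-- Element j : Fin (n - 1) of S stands for j + 1 ∈ [n-1].

Fundamental : ∀ {N} n → Subset (pred n) → Word N n → Set
Fundamental n S i =
  (∀ j → lookup i (pos j) Fin.≥ lookup i (next j)) ×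
  (∀ j → j ∈ S → lookup i (pos j) Fin.> lookup i (next j))

lookup-< : ∀ {M N n} (ι : Fin M → Fin N) → StrictlyMonotone ι → ∀ (w : Word M n) i j →
           lookup w i Fin.< lookup w j ⇔ lookup (Vec.map ι w) i Fin.< lookup (Vec.map ι w) j
lookup-< ι mono w i j rewrite Vec.lookup-map i ι w | Vec.lookup-map j ι w =
  mk⇔ mono (mono-reflects mono)

lookup-≤ : ∀ {M N n} (ι : Fin M → Fin N) → StrictlyMonotone ι → ∀ (w : Word M n) i j →
           lookup w i Fin.≤ lookup w j ⇔ lookup (Vec.map ι w) i Fin.≤ lookup (Vec.map ι w) j
lookup-≤ ι mono w i j = mk⇔
  (λ le → ℕ.≮⇒≥ (λ lt → ℕ.<⇒≱ (Equivalence.from (lookup-< ι mono w j i) lt) le))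
  (λ le → ℕ.≮⇒≥ (λ lt → ℕ.<⇒≱ (Equivalence.to (lookup-< ι mono w j i) lt) le))

lookup-≡ : ∀ {M N n} (ι : Fin M → Fin N) → StrictlyMonotone ι → ∀ (w : Word M n) i j →
           lookup w i ≡ lookup w j ⇔ lookup (Vec.map ι w) i ≡ lookup (Vec.map ι w) j
lookup-≡ ι mono w i j rewrite Vec.lookup-map i ι w | Vec.lookup-map j ι w =
  mk⇔ (cong ι) (mono-injective mono)

fundamental : ∀ n → Subset (pred n) → OrderInvariant n
fundamental n S = record
  { Holds     = Fundamental n S
  ; holds?    = λ i → Fin.all? (λ j → lookup i (next j) Fin.≤? lookup i (pos j))
                ×-dec Fin.all? (λ j → (j ∈? S) →-dec (lookup i (next j) Fin.<? lookup i (pos j)))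
  ; invariant = λ ι mono w → mk⇔
      (λ (weak , strict) →
          (λ j → Equivalence.to (lookup-≤ ι mono w (next j) (pos j)) (weak j))
        , (λ j j∈S → Equivalence.to (lookup-< ι mono w (next j) (pos j)) (strict j j∈S)))
      (λ (weak , strict) →
          (λ j → Equivalence.from (lookup-≤ ι mono w (next j) (pos j)) (weak j))
        , (λ j j∈S → Equivalence.from (lookup-< ι mono w (next j) (pos j)) (strict j j∈S)))
  }

F : ∀ n → Subset (pred n) → QSym
F n S = gen (fundamental n S)

-- The F_{n,S} form a ℚ-basis of QSym, so these two conditions determine ω
-- (and make it an involution).  Existence is ω₀-isOmega below.

record IsOmega (ω : QSym → QSym) : Set where
  field
    isLinear : IsLeftModuleHomomorphism ω
    ω-F      : ∀ n (S : Subset (pred n)) → ω (F n S) ≈Q F n (∁ S)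

record QSym[t] : Set where
  field
    coeffₜ   : ℕ → QSym
    boundedₜ : ∃ λ d → ∀ k → d < k → coeffₜ k ≈Q 0Q

open QSym[t] public

infix 4 _≈ₜ_

_≈ₜ_ : QSym[t] → QSym[t] → Set
p ≈ₜ q = ∀ k → coeffₜ p k ≈Q coeffₜ q k

0ₜ : QSym[t]
0ₜ = record { coeffₜ = λ _ → 0Q ; boundedₜ = 0 , λ _ _ → mk≈ λ _ → refl }

infixl 6 _+ₜ_

_+ₜ_ : QSym[t] → QSym[t] → QSym[t]
p +ₜ q = record
  { coeffₜ   = λ k → coeffₜ p k +Q coeffₜ q k
  ; boundedₜ = let (d , u) = boundedₜ p ; (e , v) = boundedₜ q in
      d ℕ.⊔ e , λ k lt → mk≈ λ a → cong₂ ℚ._+_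
        (coeff-≡ (u k (ℕ.≤-<-trans (ℕ.m≤m⊔n d e) lt)) a)
        (coeff-≡ (v k (ℕ.≤-<-trans (ℕ.m≤n⊔m d e) lt)) a)
  }

∑ₜ : ∀ {A : Set} → List A → (A → QSym[t]) → QSym[t]
∑ₜ xs f = foldr (λ x p → f x +ₜ p) 0ₜ xs

infix 8 _·t^_

_·t^_ : QSym → ℕ → QSym[t]
f ·t^ m = record
  { coeffₜ   = λ k → if does (k ℕ.≟ m) then f else 0Q
  ; boundedₜ = m , λ k lt → mk≈ λ a →
      cong (λ b → coeff (if b then f else 0Q) a) (dec-false (k ℕ.≟ m) (λ eq → ℕ.<⇒≢ lt (sym eq)))
  }

-- The coefficientwise extension of ω to polynomials in t.

extend : (ω : QSym → QSym) → IsLeftModuleHomomorphism ω → QSym[t] → QSym[t]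
extend ω lin p = record
  { coeffₜ   = λ k → ω (coeffₜ p k)
  ; boundedₜ = let (d , u) = boundedₜ p in
      d , λ k lt → mk≈ λ a → trans (coeff-≡ (⟦⟧-cong (u k lt)) a) (coeff-≡ 0ᴹ-homo a)
  }
  where open IsLeftModuleHomomorphism lin

-- The vertex i + 1 ∈ [n] is i : Fin n.

record Digraph (n : ℕ) : Set₁ where
  field
    E        : Rel (Fin n) 0ℓ
    E?       : Decidable E
    loopless : Irreflexive _≡_ E

  Adjacent : Rel (Fin n) 0ℓ
  Adjacent u v = E u v ⊎ E v u

  adjacent? : Decidable Adjacent
  adjacent? u v = E? u v ⊎-dec E? v u

  edges : List (Fin n × Fin n)
  edges = filter (uncurry E?) (cartesianProduct (allFin n) (allFin n))

module _ {n} (G : Digraph n) where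
  open Digraph G

  Proper : ∀ {N} → Word N n → Set
  Proper κ = ∀ u v → Adjacent u v → lookup κ u ≢ lookup κ v

  proper? : ∀ {N} → U.Decidable (Proper {N})
  proper? κ = Fin.all? λ u → Fin.all? λ v →
    adjacent? u v →-dec ¬? (lookup κ u Fin.≟ lookup κ v)

  asc : ∀ {N} → Word N n → ℕ
  asc κ = length (filter (λ (u , v) → lookup κ u Fin.<? lookup κ v) edges)

  asc-invariant : ∀ {M N} (ι : Fin M → Fin N) → StrictlyMonotone ι → ∀ κ → asc κ ≡ asc (Vec.map ι κ)
  asc-invariant ι mono κ = cong length (List.filter-≐ _ _
    ( (λ {(u , v)} → Equivalence.to (lookup-< ι mono κ u v))
    , (λ {(u , v)} → Equivalence.from (lookup-< ι mono κ u v))) edges)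

  properWithAsc : ℕ → OrderInvariant n
  properWithAsc k = record
    { Holds     = λ κ → Proper κ × asc κ ≡ k
    ; holds?    = λ κ → proper? κ ×-dec (asc κ ℕ.≟ k)
    ; invariant = λ ι mono κ → mk⇔
        (λ (p , eq) → (λ u v uv → p u v uv ∘ Equivalence.from (lookup-≡ ι mono κ u v))
                    , trans (sym (asc-invariant ι mono κ)) eq)
        (λ (p , eq) → (λ u v uv → p u v uv ∘ Equivalence.to (lookup-≡ ι mono κ u v))
                    , trans (asc-invariant ι mono κ) eq)
    }

  X : QSym[t]
  X = record
    { coeffₜ   = λ k → gen (properWithAsc k)
    ; boundedₜ = length edges , λ k lt → mk≈ λ a → cong fromℕℚ
        (filter-empty (withContent? (properWithAsc k) a)
          (λ κ (_ , _ , eq) → ℕ.<⇒≱ lt (subst (_≤ length edges) eq (List.length-filter _ edges)))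
          (words (length a) n))
    }

-- Permutations in one-line notation σ₁ σ₂ ⋯ σₙ.

𝔖 : ∀ n → List (Word n n)
𝔖 n = filter (λ σ → DecUnique.unique? Fin._≟_ (Vec.toList σ)) (words n n)

Before : ∀ {n} → Fin n → Fin n → Word n n → Set
Before x y σ = ∃₂ λ p q → p Fin.< q × lookup σ p ≡ x × lookup σ q ≡ y

before? : ∀ {n} (x y : Fin n) → U.Decidable (Before x y)
before? x y σ = Fin.any? λ p → Fin.any? λ q →
  (p Fin.<? q) ×-dec (lookup σ p Fin.≟ x) ×-dec (lookup σ q Fin.≟ y)

subwords : ∀ {A : Set} → List A → List (List A)
subwords []       = [] ∷ []
subwords (x ∷ xs) = List.map (x ∷_) (subwords xs) ++ subwords xs

module _ {n} (G : Digraph n) where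
  open Digraph G

  inv : Word n n → ℕ
  inv σ = length (filter (λ (i , j) → before? j i σ) edges)

  WalkTo : Fin n → List (Fin n) → Set
  WalkTo x τ = List.last τ ≡ just x × Linked Adjacent τ

  walkTo? : ∀ x → U.Decidable (WalkTo x)
  walkTo? x τ = Maybe.≡-dec Fin._≟_ (List.last τ) (just x) ×-dec linked? adjacent? τ

  rank : Word n n → Fin n → ℕ
  rank σ x = max 0 (List.map length (filter (walkTo? x) (subwords (Vec.toList σ))))

  GDescent : Word n n → Fin (pred n) → Set
  GDescent σ i =
    rank σ (lookup σ (pos i)) > rank σ (lookup σ (next i)) ⊎
    (rank σ (lookup σ (pos i)) ≡ rank σ (lookup σ (next i)) ×
     lookup σ (pos i) Fin.> lookup σ (next i))

  gDescent? : ∀ σ → U.Decidable (GDescent σ)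
  gDescent? σ i =
    (rank σ (lookup σ (next i)) ℕ.<? rank σ (lookup σ (pos i))) ⊎-dec
    ((rank σ (lookup σ (pos i)) ℕ.≟ rank σ (lookup σ (next i))) ×-dec
     (lookup σ (next i) Fin.<? lookup σ (pos i)))

  DES : Word n n → Subset (pred n)
  DES σ = Vec.tabulate λ i → does (gDescent? σ i)

-- The value of ω f at x^a is read off from the weakly decreasing words w
-- of content a, of which there is exactly one.  The coefficient of
-- F_{n,S} at subsetMonomial T is 1 if S ⊆ T and 0 otherwise, so the
-- coefficient of F_{n,[n-1]∖S} at x^a is an alternating sum of these over
-- the sets T containing the descent set of w.

signedSum : ∀ {k} → Subset k → (Subset k → ℚ) → ℚ
signedSum []          h = h []
signedSum (true ∷ D)  h = signedSum D (h ∘ (true ∷_))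
signedSum (false ∷ D) h = signedSum D (h ∘ (true ∷_)) ℚ.- signedSum D (h ∘ (false ∷_))

descents : ∀ {N n} → Word N n → Subset (pred n)
descents w = Vec.tabulate λ j → does (lookup w (next j) Fin.<? lookup w (pos j))

raise : ∀ {N k} → Bool → Word N (suc k) → Word (suc N) (suc (suc k))
raise {N} true  w       = fromℕ N ∷ Vec.map inject₁ w
raise     false (x ∷ w) = inject₁ x ∷ Vec.map inject₁ (x ∷ w)

subsetWord : ∀ {k} → Subset k → Word (suc k) (suc k)
subsetWord []      = zero ∷ []
subsetWord (b ∷ T) = raise b (subsetWord T)

subsetMonomial : ∀ n → Subset (pred n) → Monomial
subsetMonomial zero    T = []
subsetMonomial (suc n) T = content (subsetWord T)

∑ : ∀ {A : Set} → List A → (A → ℚ) → ℚ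
∑ xs f = foldr (λ x q → f x ℚ.+ q) 0ℚ xs

Decreasing : ∀ n → OrderInvariant n
Decreasing n = fundamental n (Vec.replicate _ false)

decreasingWords : ∀ n (a : Monomial) → List (Word (length a) n)
decreasingWords n a = filter (withContent? (Decreasing n) a) (words (length a) n)

ω₀-coeff : QSym → Monomial → ℚ
ω₀-coeff f a = ∑ (decreasingWords (sum a) a) λ w →
  signedSum (descents w) (coeff f ∘ subsetMonomial (sum a))

∑-cong : ∀ {A : Set} (xs : List A) {f g : A → ℚ} → f ≗ g → ∑ xs f ≡ ∑ xs g
∑-cong []       eq = refl
∑-cong (x ∷ xs) eq = cong₂ ℚ._+_ (eq x) (∑-cong xs eq)

interchange : ∀ a b c d → (a ℚ.+ b) ℚ.+ (c ℚ.+ d) ≡ (a ℚ.+ c) ℚ.+ (b ℚ.+ d)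
interchange = CommutativeSemigroup.interchange
  (record { isCommutativeSemigroup = IsCommutativeMonoid.isCommutativeSemigroup ℚ.+-0-isCommutativeMonoid })

∑-+ : ∀ {A : Set} (xs : List A) (f g : A → ℚ) → ∑ xs (λ x → f x ℚ.+ g x) ≡ ∑ xs f ℚ.+ ∑ xs g
∑-+ []       f g = refl
∑-+ (x ∷ xs) f g = trans (cong (f x ℚ.+ g x ℚ.+_) (∑-+ xs f g)) (interchange (f x) (g x) _ _)

∑-* : ∀ {A : Set} (xs : List A) c (f : A → ℚ) → ∑ xs (λ x → c ℚ.* f x) ≡ c ℚ.* ∑ xs f
∑-* []       c f = sym (ℚ.*-zeroʳ c)
∑-* (x ∷ xs) c f = trans (cong (c ℚ.* f x ℚ.+_) (∑-* xs c f)) (sym (ℚ.*-distribˡ-+ c (f x) _))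

∑-0 : ∀ {A : Set} (xs : List A) {f : A → ℚ} → (∀ x → f x ≡ 0ℚ) → ∑ xs f ≡ 0ℚ
∑-0 []       eq = refl
∑-0 (x ∷ xs) eq = cong₂ ℚ._+_ (eq x) (∑-0 xs eq)

signedSum-cong : ∀ {k} (D : Subset k) {g h} → g ≗ h → signedSum D g ≡ signedSum D h
signedSum-cong []          eq = eq []
signedSum-cong (true ∷ D)  eq = signedSum-cong D (eq ∘ (true ∷_))
signedSum-cong (false ∷ D) eq =
  cong₂ ℚ._-_ (signedSum-cong D (eq ∘ (true ∷_))) (signedSum-cong D (eq ∘ (false ∷_)))

signedSum-* : ∀ {k} (D : Subset k) c h → signedSum D (λ T → c ℚ.* h T) ≡ c ℚ.* signedSum D h
signedSum-* []          c h = refl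
signedSum-* (true ∷ D)  c h = signedSum-* D c _
signedSum-* (false ∷ D) c h = trans
  (cong₂ ℚ._-_ (signedSum-* D c _) (signedSum-* D c _))
  (trans (cong (c ℚ.* p ℚ.+_) (ℚ.neg-distribʳ-* c q)) (sym (ℚ.*-distribˡ-+ c p (ℚ.- q))))
  where
  p = signedSum D (h ∘ (true ∷_))
  q = signedSum D (h ∘ (false ∷_))

signedSum-+ : ∀ {k} (D : Subset k) g h →
              signedSum D (λ T → g T ℚ.+ h T) ≡ signedSum D g ℚ.+ signedSum D h
signedSum-+ []          g h = refl
signedSum-+ (true ∷ D)  g h = signedSum-+ D _ _
signedSum-+ (false ∷ D) g h = trans
  (cong₂ ℚ._-_ (signedSum-+ D (g ∘ (true ∷_)) (h ∘ (true ∷_)))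
               (signedSum-+ D (g ∘ (false ∷_)) (h ∘ (false ∷_))))
  (trans (cong (p ℚ.+ r ℚ.+_) (ℚ.neg-distrib-+ q s)) (interchange p r (ℚ.- q) (ℚ.- s)))
  where
  p = signedSum D (g ∘ (true ∷_))
  q = signedSum D (g ∘ (false ∷_))
  r = signedSum D (h ∘ (true ∷_))
  s = signedSum D (h ∘ (false ∷_))

signedSum-0 : ∀ {k} (D : Subset k) {h} → (∀ T → h T ≡ 0ℚ) → signedSum D h ≡ 0ℚ
signedSum-0 []          eq = eq []
signedSum-0 (true ∷ D)  eq = signedSum-0 D (eq ∘ (true ∷_))
signedSum-0 (false ∷ D) eq =
  cong₂ ℚ._-_ (signedSum-0 D (eq ∘ (true ∷_))) (signedSum-0 D (eq ∘ (false ∷_)))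

[_] : ∀ {P : Set} → Dec P → ℚ
[ p ] = if does p then 1ℚ else 0ℚ

[]-cong : ∀ {P Q : Set} (p : Dec P) (q : Dec Q) → P ⇔ Q → [ p ] ≡ [ q ]
[]-cong (yes p) (yes q) eq = refl
[]-cong (no ¬p) (no ¬q) eq = refl
[]-cong (yes p) (no ¬q) eq = contradiction (Equivalence.to eq p) ¬q
[]-cong (no ¬p) (yes q) eq = contradiction (Equivalence.from eq q) ¬p

[no] : ∀ {P : Set} (p : Dec P) → ¬ P → [ p ] ≡ 0ℚ
[no] (yes p) ¬p = contradiction p ¬p
[no] (no _)  ¬p = refl

∷⇔ : ∀ {k} {S T : Subset k} s t → (s ≡ true → t ≡ true) → S ⊆ T ⇔ (s ∷ S) ⊆ (t ∷ T)
∷⇔ s true  le = mk⇔ (λ ST → λ { Vec.here → Vec.here ; (Vec.there p) → Vec.there (ST p) }) Subset.drop-∷-⊆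
∷⇔ true  false le = case le refl of λ ()
∷⇔ false false le = mk⇔ (λ ST → λ { {zero} () ; {suc j} (Vec.there p) → Vec.there (ST p) }) Subset.drop-∷-⊆

not-∷ : ∀ {k} {S T : Subset k} → ¬ (true ∷ S) ⊆ (false ∷ T)
not-∷ ST = case ST Vec.here of λ ()

signedSum-⊆ : ∀ {k} (D S : Subset k) → signedSum D (λ T → [ S ⊆? T ]) ≡ [ ∁ S ⊆? D ]
signedSum-⊆ []          []          = refl
signedSum-⊆ (true ∷ D)  (s ∷ S)     = trans
  (signedSum-cong D (λ T → []-cong (s ∷ S ⊆? true ∷ T) (S ⊆? T) (⇔-sym (∷⇔ s true (λ _ → refl)))))
  (trans (signedSum-⊆ D S) ([]-cong (∁ S ⊆? D) (∁ (s ∷ S) ⊆? true ∷ D) (∷⇔ (not s) true (λ _ → refl))))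
signedSum-⊆ (false ∷ D) (true ∷ S)  = trans
  (cong₂ ℚ._-_
    (signedSum-cong D (λ T → []-cong (true ∷ S ⊆? true ∷ T) (S ⊆? T) (⇔-sym (∷⇔ true true (λ _ → refl)))))
    (signedSum-0 D (λ T → [no] (true ∷ S ⊆? false ∷ T) not-∷)))
  (trans (ℚ.+-identityʳ _)
  (trans (signedSum-⊆ D S) ([]-cong (∁ S ⊆? D) (∁ (true ∷ S) ⊆? false ∷ D) (∷⇔ false false id))))
signedSum-⊆ (false ∷ D) (false ∷ S) = trans
  (cong₂ ℚ._-_
    (signedSum-cong D (λ T → []-cong (false ∷ S ⊆? true ∷ T) (S ⊆? T) (⇔-sym (∷⇔ false true (λ _ → refl)))))
    (signedSum-cong D (λ T → []-cong (false ∷ S ⊆? false ∷ T) (S ⊆? T) (⇔-sym (∷⇔ false false id)))))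
  (trans (ℚ.+-inverseʳ (signedSum D (λ T → [ S ⊆? T ])))
         (sym ([no] (∁ (false ∷ S) ⊆? false ∷ D) not-∷)))

descents-∈ : ∀ {N n} (w : Word N n) j → j ∈ descents w ⇔ lookup w (next j) Fin.< lookup w (pos j)
descents-∈ w j with lookup w (next j) Fin.<? lookup w (pos j) in eq
... | yes lt = mk⇔ (λ _ → lt) (λ _ → Vec.lookup⇒[]= j (descents w)
                 (trans (Vec.lookup∘tabulate _ j) (cong does eq)))
... | no ¬lt = mk⇔ (λ j∈ → case trans (sym (Vec.[]=⇒lookup j∈))
                               (trans (Vec.lookup∘tabulate _ j) (cong does eq)) of λ ())
                   (λ lt → contradiction lt ¬lt)

Weak : ∀ {N n} → Word N n → Set
Weak w = ∀ j → lookup w (next j) Fin.≤ lookup w (pos j)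

⊆-descents : ∀ {N n} S (w : Word N n) → Weak w → S ⊆ descents w ⇔ Fundamental n S w
⊆-descents S w weak = mk⇔
  (λ sub → weak , λ j j∈ → Equivalence.to (descents-∈ w j) (sub j∈))
  (λ (_ , strict) {j} j∈ → Equivalence.from (descents-∈ w j) (strict j j∈))

weak⇒decreasing : ∀ {N n} {w : Word N n} → Weak w → Holds (Decreasing n) w
weak⇒decreasing weak = weak , λ j j∈ →
  case trans (sym (Vec.[]=⇒lookup j∈)) (Vec.lookup-replicate j false) of λ ()

head-max : ∀ {N n} (x : Fin N) (w : Word N n) → Weak (x ∷ w) → ∀ i → lookup w i Fin.≤ x
head-max x (y ∷ w) weak zero    = weak zero
head-max x (y ∷ w) weak (suc i) = ℕ.≤-trans (head-max y w (weak ∘ suc) i) (weak zero)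

tail-weak : ∀ {N n} (x : Fin N) (w : Word N n) → Weak (x ∷ w) → Weak w
tail-weak x (y ∷ w) weak = weak ∘ suc

occ>0⇒∈ : ∀ {N n} c (w : Word N n) → 0 < occ c w → ∃ λ i → lookup w i ≡ c
occ>0⇒∈ c (x ∷ w) gt with c Fin.≟ x
... | yes refl = zero , refl
... | no _     = let (i , eq) = occ>0⇒∈ c w gt in suc i , eq

head-≤ : ∀ {N n} (x : Fin N) (v : Word N n) y (w : Word N n) → Weak (y ∷ w) → (∀ c → occ c (x ∷ v) ≡ occ c (y ∷ w)) → x Fin.≤ y
head-≤ x v y w weak eq with occ>0⇒∈ x (y ∷ w) (subst (0 <_) (eq x) (occ>0 (x ∷ v) zero))
... | zero  , refl = ℕ.≤-refl
... | suc i , e    = subst (Fin._≤ y) e (head-max y w weak i)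

weak-unique : ∀ {N n} (v w : Word N n) → Weak v → Weak w → (∀ c → occ c v ≡ occ c w) → v ≡ w
weak-unique []      []      _  _  _  = refl
weak-unique (x ∷ v) (y ∷ w) dv dw eq
  with Fin.≤-antisym (head-≤ x v y w dw eq) (head-≤ y w x v dv (sym ∘ eq))
... | refl = cong (x ∷_) (weak-unique v w (tail-weak x v dv) (tail-weak x w dw) tails)
  where
  tails : ∀ c → occ c v ≡ occ c w
  tails c with c Fin.≟ x | eq c
  ... | yes _ | e = ℕ.suc-injective e
  ... | no _  | e = e

F-coeff : ∀ {N n} S (u : Word N n) a → N ≡ length a → content u ≡ a → Weak u →
          coeff (F n S) a ≡ [ S ⊆? descents u ]
F-coeff {n = n} S u a refl eq weak = go (S ⊆? descents u)
  where
  P? : U.Decidable (WithContent (fundamental n S) a)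
  P? = withContent? (fundamental n S) a

  ws : List (Word (length a) n)
  ws = words (length a) n

  unique : ∀ {w} → WithContent (fundamental n S) a w → w ≡ u
  unique {w} (e , h) = weak-unique w u (proj₁ h) weak (tabulate-inj (trans e (sym eq)))

  one : S ⊆ descents u → length (filter P? ws) ≡ 1
  one sub = same-length {xs = filter P? ws} {ys = u ∷ []}
    (Unique.filter⁺ P? (words-unique (length a) n)) ([] AllPairs.∷ AllPairs.[])
    (mk⇔ (λ w∈ → here (unique (proj₂ (∈List.∈-filter⁻ P? {xs = ws} w∈))))
         (λ { (here refl) → ∈List.∈-filter⁺ P? (words-complete u)
                              (eq , Equivalence.to (⊆-descents S u weak) sub) }))

  none : ¬ S ⊆ descents u → length (filter P? ws) ≡ 0
  none ¬sub = filter-empty P? (λ w p → ¬sub λ {j} → Equivalence.from (⊆-descents S u weak)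
    (subst (Fundamental n S) (unique {w} p) (proj₂ p)) {j}) ws

  go : (d : Dec (S ⊆ descents u)) → fromℕℚ (length (filter P? ws)) ≡ [ d ]
  go (yes sub) = cong fromℕℚ (one sub)
  go (no ¬sub) = cong fromℕℚ (none ¬sub)

inject₁-mono : ∀ {N} → StrictlyMonotone (inject₁ {N})
inject₁-mono {i = i} {j} lt = subst₂ ℕ._<_ (sym (Fin.toℕ-inject₁ i)) (sym (Fin.toℕ-inject₁ j)) lt

weak-map : ∀ {M N n} {ι : Fin M → Fin N} → StrictlyMonotone ι → ∀ (w : Word M n) → Weak w → Weak (Vec.map ι w)
weak-map mono w weak j = Equivalence.to (lookup-≤ _ mono w (next j) (pos j)) (weak j)

weak-∷ : ∀ {N n} (x y : Fin N) (w : Word N n) → y Fin.≤ x → Weak (y ∷ w) → Weak (x ∷ y ∷ w)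
weak-∷ x y w le weak zero    = le
weak-∷ x y w le weak (suc j) = weak j

inject₁<fromℕ : ∀ {N} (x : Fin N) → inject₁ x Fin.< fromℕ N
inject₁<fromℕ {N} x = subst₂ ℕ._<_ (sym (Fin.toℕ-inject₁ x)) (sym (Fin.toℕ-fromℕ N)) (Fin.toℕ<n x)

subsetWord-weak : ∀ {k} (T : Subset k) → Weak (subsetWord T)
subsetWord-weak []          ()
subsetWord-weak (b ∷ T) with subsetWord T | subsetWord-weak T
subsetWord-weak (true ∷ T)  | x ∷ w | weak =
  weak-∷ _ _ (Vec.map inject₁ w) (ℕ.<⇒≤ (inject₁<fromℕ x)) (weak-map inject₁-mono (x ∷ w) weak)
subsetWord-weak (false ∷ T) | x ∷ w | weak =
  weak-∷ _ _ (Vec.map inject₁ w) ℕ.≤-refl (weak-map inject₁-mono (x ∷ w) weak)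

descents-map : ∀ {M N n} {ι : Fin M → Fin N} → StrictlyMonotone ι → ∀ (w : Word M n) →
               descents (Vec.map ι w) ≡ descents w
descents-map mono w = Vec.tabulate-cong λ j →
  does-⇔ (⇔-sym (lookup-< _ mono w (next j) (pos j))) (_ Fin.<? _) (_ Fin.<? _)

descents-subsetWord : ∀ {k} (T : Subset k) → descents (subsetWord T) ≡ T
descents-subsetWord []      = refl
descents-subsetWord (b ∷ T) with subsetWord T | descents-subsetWord T
descents-subsetWord (true ∷ T)  | x ∷ w | eq = cong₂ _∷_
  (dec-true (inject₁ x Fin.<? fromℕ _) (inject₁<fromℕ x))
  (trans (descents-map inject₁-mono (x ∷ w)) eq)
descents-subsetWord (false ∷ T) | x ∷ w | eq = cong₂ _∷_
  (dec-false (inject₁ x Fin.<? inject₁ x) (Fin.<-irrefl refl))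
  (trans (descents-map inject₁-mono (x ∷ w)) eq)

F-subsetMonomial : ∀ n (S T : Subset (pred n)) → coeff (F n S) (subsetMonomial n T) ≡ [ S ⊆? T ]
F-subsetMonomial zero    [] [] = refl
F-subsetMonomial (suc n) S  T  = trans
  (F-coeff S (subsetWord T) (content (subsetWord T)) 
    (sym (List.length-tabulate (λ c → occ c (subsetWord T)))) refl (subsetWord-weak T))
  (cong (λ T → [ S ⊆? T ]) (descents-subsetWord T))

sum-subsetMonomial : ∀ n (T : Subset (pred n)) → sum (subsetMonomial n T) ≡ n
sum-subsetMonomial zero    T = refl
sum-subsetMonomial (suc n) T = sum-content (subsetWord T)

sum-nonzero : ∀ a → sum (nonzero a) ≡ sum a
sum-nonzero []          = refl
sum-nonzero (zero ∷ a)  = sum-nonzero a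
sum-nonzero (suc k ∷ a) = cong (suc k ℕ.+_) (sum-nonzero a)

ω₀ : QSym → QSym
ω₀ f = record
  { coeff   = ω₀-coeff f ∘ nonzero
  ; quasi   = λ a b eq → cong (ω₀-coeff f) eq
  ; bounded = let (d , p) = bounded f in d , λ a lt →
      ∑-0 (decreasingWords (sum (nonzero a)) (nonzero a)) λ w → signedSum-0 (descents w) λ T →
        p (subsetMonomial (sum (nonzero a)) T)
          (subst (d <_) (sym (trans (sum-subsetMonomial (sum (nonzero a)) T) (sum-nonzero a))) lt)
  }

fromℕℚ-suc : ∀ k → fromℕℚ (suc k) ≡ 1ℚ ℚ.+ fromℕℚ k
fromℕℚ-suc k = sym (trans
  (cong (1ℚ ℚ.+_) (ℚ.normalize-coprime {k} {0} (Coprime.sym (Coprime.1-coprimeTo k))))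
  (cong (λ z → z ℚ./ 1) (cong (ℤ._+_ ℤ.1ℤ) (ℤ.*-identityʳ (ℤ.+ k)))))

∑-[] : ∀ {A : Set} {P R : U.Pred A 0ℓ} (P? : U.Decidable P) (R? : U.Decidable R)
       (q : A → ℚ) → (∀ x → P x → q x ≡ [ R? x ]) → (∀ x → R x → P x) →
       ∀ xs → ∑ (filter P? xs) q ≡ fromℕℚ (length (filter R? xs))
∑-[] P? R? q eq RP []       = refl
∑-[] P? R? q eq RP (x ∷ xs) with P? x | R? x in e
... | yes p | yes r = trans (cong₂ ℚ._+_ (trans (eq x p) (cong (λ r → [ r ]) e)) (∑-[] P? R? q eq RP xs)) (sym (fromℕℚ-suc (length (filter R? xs))))
... | yes p | no _  = trans (cong₂ ℚ._+_ (trans (eq x p) (cong (λ r → [ r ]) e)) (∑-[] P? R? q eq RP xs)) (ℚ.+-identityˡ _)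
... | no ¬p | yes r = contradiction (RP x r) ¬p
... | no _  | no _  = ∑-[] P? R? q eq RP xs

ω₀-F-coeff : ∀ n S a → ω₀-coeff (F n S) a ≡ coeff (F n (∁ S)) a
ω₀-F-coeff n S a = go n S (sum a ℕ.≟ n)
  where
  addContent : ∀ {A B C : Set} → A → B ⇔ C → B ⇔ (A × C)
  addContent a e = mk⇔ (λ b → a , Equivalence.to e b) (λ (_ , c) → Equivalence.from e c)

  same : ∀ S w → WithContent (Decreasing (sum a)) a w →
         signedSum (descents w) (coeff (F (sum a) S) ∘ subsetMonomial (sum a)) ≡
         [ withContent? (fundamental (sum a) (∁ S)) a w ]
  same S w (eq , h) = trans
    (signedSum-cong (descents w) (F-subsetMonomial (sum a) S))
    (trans (signedSum-⊆ (descents w) S)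
      ([]-cong (∁ S ⊆? descents w) (withContent? (fundamental (sum a) (∁ S)) a w)
        (addContent eq (⊆-descents (∁ S) w (proj₁ h)))))

  go : ∀ n S → Dec (sum a ≡ n) → ω₀-coeff (F n S) a ≡ coeff (F n (∁ S)) a
  go n S (no ne) = trans
    (∑-0 (decreasingWords (sum a) a) λ w → signedSum-0 (descents w) λ T →
       genCoeff-degree (fundamental n S) (subsetMonomial (sum a) T) (ne ∘ trans (sym (sum-subsetMonomial (sum a) T))))
    (sym (genCoeff-degree (fundamental n (∁ S)) a ne))
  go n S (yes refl) = ∑-[]
    {P = WithContent (Decreasing (sum a)) a}
    {R = WithContent (fundamental (sum a) (∁ S)) a}
    (withContent? (Decreasing (sum a)) a) (withContent? (fundamental (sum a) (∁ S)) a)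
    (λ w → signedSum (descents w) (coeff (F (sum a) S) ∘ subsetMonomial (sum a)))
    (same S)
    (λ w (eq , h) → eq , weak⇒decreasing {w = w} (proj₁ h))
    (words (length a) (sum a))

ω₀-term : QSym → (a : Monomial) → Word (length a) (sum a) → ℚ
ω₀-term f a w = signedSum (descents w) (coeff f ∘ subsetMonomial (sum a))

ω₀-cong : ∀ f g → f ≈Q g → ∀ a → ω₀-coeff f a ≡ ω₀-coeff g a
ω₀-cong f g f≈g a = ∑-cong (decreasingWords (sum a) a) {ω₀-term f a} {ω₀-term g a} λ w →
  signedSum-cong (descents w) λ T → coeff-≡ f≈g (subsetMonomial (sum a) T)

ω₀-+ : ∀ f g a → ω₀-coeff (f +Q g) a ≡ ω₀-coeff f a ℚ.+ ω₀-coeff g a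
ω₀-+ f g a = trans
  (∑-cong (decreasingWords (sum a) a) λ w →
    signedSum-+ (descents w) (coeff f ∘ subsetMonomial (sum a)) (coeff g ∘ subsetMonomial (sum a)))
  (∑-+ (decreasingWords (sum a) a) (ω₀-term f a) (ω₀-term g a))

ω₀-· : ∀ c f a → ω₀-coeff (c ·Q f) a ≡ c ℚ.* ω₀-coeff f a
ω₀-· c f a = trans
  (∑-cong (decreasingWords (sum a) a) λ w →
    signedSum-* (descents w) c (coeff f ∘ subsetMonomial (sum a)))
  (∑-* (decreasingWords (sum a) a) c (ω₀-term f a))

ω₀-isOmega : IsOmega ω₀
ω₀-isOmega = record
  { isLinear = record
    { +ᴹ-isGroupHomomorphism = record
      { isMonoidHomomorphism = record
        { isMagmaHomomorphism = record
          { isRelHomomorphism = record { cong = λ {f} {g} p → mk≈ (ω₀-cong f g p ∘ nonzero) }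
          ; homo = λ f g → mk≈ (ω₀-+ f g ∘ nonzero)
          }
        ; ε-homo = mk≈ λ a → ∑-0 (decreasingWords (sum (nonzero a)) (nonzero a)) λ w →
            signedSum-0 (descents w) λ _ → refl
        }
      ; ⁻¹-homo = λ f → mk≈ λ a → trans
          (ω₀-cong (-Q f) (ℚ.- 1ℚ ·Q f) (mk≈ λ b → neg (coeff f b)) (nonzero a))
          (trans (ω₀-· (ℚ.- 1ℚ) f (nonzero a)) (sym (neg (ω₀-coeff f (nonzero a)))))
      }
    ; *ₗ-homo = λ c f → mk≈ (ω₀-· c f ∘ nonzero)
    }
  ; ω-F = λ n S → mk≈ λ a → trans (ω₀-F-coeff n S (nonzero a))
      (genCoeff-nonzero (fundamental n (∁ S)) a)
  }
  where
  neg : ∀ x → ℚ.- x ≡ ℚ.- 1ℚ ℚ.* x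
  neg x = trans (cong ℚ.-_ (sym (ℚ.*-identityˡ x))) (ℚ.neg-distribˡ-* 1ℚ x)

{-# OPTIONS --safe #-}
module Submission where

-- By linearity it suffices to show that the coefficient of t^k in X is the sum
-- of F_{n,[n-1]∖DES(σ)} over the σ with inv σ = k.  A pair of such a σ and a
-- weakly decreasing word w, strictly decreasing at every position outside
-- DES(σ), encodes the colouring κ with κ(σᵢ) = wᵢ.  Equal colours occupy a run
-- of G-descents, along which the rank does not increase, whereas it increases
-- strictly from a vertex to a later neighbour; so κ is proper, and then its
-- ascents are the edges counted by inv σ.  Conversely, if κ is proper and σ
-- lists the vertices by weakly decreasing colour, the subwords of σ that are
-- walks have strictly decreasing colours.  Each is therefore a subword of every
-- other such listing, so the ranks depend on κ only, and σ is recovered by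
-- sorting the vertices by colour, rank and label.

open import Defs
open import Algebra.Lattice.Properties.BooleanAlgebra using (¬-involutive)
open import Data.Bool.Base using (true; false; if_then_else_)
open import Data.Fin.Base as Fin using (Fin; zero; suc; punchOut)
import Data.Fin.Properties as Fin
open import Data.Fin.Subset using (Subset; _∈_; ∁)
open import Data.Fin.Subset.Properties using (x∈∁p⇒x∉p; x∉p⇒x∈∁p; ∪-∩-booleanAlgebra)
open import Data.List.Base as List using (List; []; _∷_; _++_; length; filter; allFin; cartesianProduct)
open import Data.List.Extrema.Nat using (max≤v⁺; max<v⁺; xs≤max)
import Data.List.Membership.Propositional as ∈List
open import Data.List.Membership.Propositional.Properties
  using (∈-map⁺; ∈-map⁻; ∈-++⁺ˡ; ∈-++⁺ʳ; ∈-++⁻; ∈-filter⁺; ∈-filter⁻; ∈-cartesianProduct⁺; ∈-cartesianProduct⁻)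
open import Data.List.Membership.Propositional.Properties.WithK using (unique∧set⇒bag)
import Data.List.Properties as List
open import Data.List.Relation.Binary.BagAndSetEquality using (∼bag⇒↭)
open import Data.List.Relation.Binary.Permutation.Propositional using (_↭_; ↭-sym; ↭⇒↭ₛ)
open import Data.List.Relation.Binary.Permutation.Propositional.Properties 
  using (↭-length; filter-↭) renaming (map⁺ to ↭-map⁺)
open import Data.List.Relation.Binary.Permutation.Setoid.Properties using (Unique-resp-↭)
open import Data.List.Relation.Binary.Sublist.Propositional using (_⊆_; []; _∷_; _∷ʳ_; minimum; ⊆-antisym)
open import Data.List.Relation.Binary.Sublist.Propositional.Properties using (All-resp-⊆)
import Data.List.Relation.Unary.All as All
import Data.List.Relation.Unary.All.Properties as All
open import Data.List.Relation.Unary.All using (All; []; _∷_)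
open import Data.List.Relation.Unary.AllPairs using (AllPairs; []; _∷_)
import Data.List.Relation.Unary.AllPairs as AllPairs
open import Data.List.Relation.Unary.Any using (here; there)
open import Data.List.Relation.Unary.Linked as Linked using ([-])
import Data.List.Relation.Unary.Linked.Properties as Linked
open import Data.List.Relation.Unary.Unique.DecPropositional using (unique?)
open import Data.List.Relation.Unary.Unique.Propositional using (Unique)
import Data.List.Relation.Unary.Unique.Propositional.Properties as Unique
open import Data.List.Sort using (sort; sort-↭; sort-↗)
open import Data.Maybe.Base using (just)
open import Data.Maybe.Relation.Binary.Connected using (Connected; just)
open import Data.Nat.Base as ℕ using (ℕ; zero; suc; pred; _≥_)
import Data.Nat.Properties as ℕ
open import Data.Product.Base using (∃; _×_; _,_; proj₁; proj₂)
open import Data.Product.Relation.Binary.Lex.Strict using (×-strictTotalOrder)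
open import Data.Rational.Base as ℚ using (1ℚ)
import Data.Rational.Properties as ℚ
open import Data.Sum.Base using (inj₁; inj₂; swap; [_,_]′)
open import Data.Vec.Base as Vec using (Vec; []; _∷_; lookup; toList)
import Data.Vec.Properties as Vec
import Data.Vec.Relation.Unary.All.Properties as VecAll
open import Function.Base using (_∘_; id)
open import Function.Bundles using (_⇔_; mk⇔; Equivalence)
open import Level using (0ℓ)
open import Relation.Binary.Bundles using (StrictTotalOrder; DecTotalOrder)
import Relation.Binary.Construct.Flip.EqAndOrd as Flip
import Relation.Binary.Construct.On as On
open import Relation.Binary.Core using (Rel)
open import Relation.Binary.Definitions using (Irreflexive; Transitive; tri<; tri≈; tri>)
open import Relation.Binary.Properties.StrictTotalOrder using (decTotalOrder)
open import Relation.Binary.PropositionalEquality hiding ([_])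
open import Relation.Nullary using (¬_; Dec; yes; no; does; contradiction)
open import Relation.Nullary.Decidable using (_×-dec_; dec-true; dec-false)
import Relation.Unary as U

-- Subwords, and counting by filtered lists.

module _ {A : Set} where

  AllPairs-resp-⊆ : {R : Rel A 0ℓ} → ∀ {xs ys} → xs ⊆ ys → AllPairs R ys → AllPairs R xs
  AllPairs-resp-⊆ []         []       = []
  AllPairs-resp-⊆ (y ∷ʳ p)   (_ ∷ rs) = AllPairs-resp-⊆ p rs
  AllPairs-resp-⊆ (refl ∷ p) (r ∷ rs) = All-resp-⊆ p r ∷ AllPairs-resp-⊆ p rs

  -- Greedy matching: while the head of `ys` differs from the matched occurrence of `x`, it is
  -- skipped, and no later entry of `xs` can equal it, because that entry lies above `x` whereas `x`
  -- still occurs further on in `ys`. Entries of `ys` that are incomparable under `≺` may stand in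
  -- any order.
  strict⊆ : (_≺_ : Rel A 0ℓ) → Irreflexive _≡_ _≺_ → ∀ {xs ys} →
            AllPairs _≺_ xs → AllPairs (λ x y → ¬ y ≺ x) ys → All (∈List._∈ ys) xs → xs ⊆ ys
  strict⊆ _≺_ irr {[]} {ys} _ _ _ = minimum ys
  strict⊆ _≺_ irr {x ∷ xs} {.x ∷ ys} (p ∷ ps) (_ ∷ qs) (here refl ∷ ms) =
    refl ∷ strict⊆ _≺_ irr ps qs (All.zipWith later (p , ms))
    where
    later : ∀ {z} → x ≺ z × z ∈List.∈ x ∷ ys → z ∈List.∈ ys
    later (x≺z , here refl) = contradiction x≺z (irr refl)
    later (_   , there z∈)  = z∈
  strict⊆ _≺_ irr {x ∷ xs} {y ∷ ys} (p ∷ ps) (q ∷ qs) (there x∈ ∷ ms) =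
    y ∷ʳ strict⊆ _≺_ irr (p ∷ ps) qs (x∈ ∷ All.zipWith later (p , ms))
    where
    later : ∀ {z} → x ≺ z × z ∈List.∈ y ∷ ys → z ∈List.∈ ys
    later (x≺z , here refl) = contradiction x≺z (All.lookup q x∈)
    later (_   , there z∈)  = z∈

  ∈-subwords⁺ : ∀ {xs ys : List A} → xs ⊆ ys → xs ∈List.∈ subwords ys
  ∈-subwords⁺ []                       = here refl
  ∈-subwords⁺ {ys = _ ∷ ys} (y ∷ʳ p)   = ∈-++⁺ʳ (List.map (y ∷_) (subwords ys)) (∈-subwords⁺ p)
  ∈-subwords⁺               (refl ∷ p) = ∈-++⁺ˡ (∈-map⁺ _ (∈-subwords⁺ p))

  ∈-subwords⁻ : ∀ {xs : List A} ys → xs ∈List.∈ subwords ys → xs ⊆ ys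
  ∈-subwords⁻ []       (here refl) = []
  ∈-subwords⁻ (y ∷ ys) xs∈ with ∈-++⁻ (List.map (y ∷_) (subwords ys)) xs∈
  ... | inj₂ later = y ∷ʳ ∈-subwords⁻ ys later
  ... | inj₁ now with ∈-map⁻ (y ∷_) now
  ...   | _ , xs′∈ , refl = refl ∷ ∈-subwords⁻ ys xs′∈

  last-∷ʳ : ∀ (xs : List A) y → List.last (xs List.∷ʳ y) ≡ just y
  last-∷ʳ []           y = refl
  last-∷ʳ (x ∷ [])     y = refl
  last-∷ʳ (x ∷ z ∷ xs) y = last-∷ʳ (z ∷ xs) y

  length-∷ʳ : ∀ (xs : List A) y → length (xs List.∷ʳ y) ≡ suc (length xs)
  length-∷ʳ xs y = trans (List.length-++ xs) (ℕ.+-comm (length xs) 1)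

  toList-allPairs⁺ : ∀ {R : Rel A 0ℓ} {n} (w : Vec A n) →
    (∀ {i j} → i Fin.< j → R (lookup w i) (lookup w j)) → AllPairs R (toList w)
  toList-allPairs⁺ []      r = []
  toList-allPairs⁺ (x ∷ w) r =
    VecAll.toList⁺ (VecAll.lookup⁻ (λ _ → r ℕ.z<s)) ∷ toList-allPairs⁺ w (r ∘ ℕ.s<s)

  toList-allPairs⁻ : ∀ {R : Rel A 0ℓ} {n} (w : Vec A n) → AllPairs R (toList w) →
    ∀ {i j} → i Fin.< j → R (lookup w i) (lookup w j)
  toList-allPairs⁻ (x ∷ w) (r ∷ rs) {zero}  {suc j} lt         = VecAll.lookup⁺ (VecAll.toList⁻ r) j
  toList-allPairs⁻ (x ∷ w) (r ∷ rs) {suc i} {suc j} (ℕ.s<s lt) = toList-allPairs⁻ w rs lt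

  consecutive⇒< : ∀ (R : Rel A 0ℓ) → Transitive R → ∀ {n} (w : Vec A n) →
    (∀ j → R (lookup w (pos j)) (lookup w (next j))) → ∀ {i j} → i Fin.< j → R (lookup w i) (lookup w j)
  consecutive⇒< R tr (x ∷ y ∷ w) r {zero}  {suc zero}    lt         = r zero
  consecutive⇒< R tr (x ∷ y ∷ w) r {zero}  {suc (suc j)} lt         =
    tr (r zero) (consecutive⇒< R tr (y ∷ w) (r ∘ suc) {zero} {suc j} ℕ.z<s)
  consecutive⇒< R tr (x ∷ y ∷ w) r {suc i} {suc j}       (ℕ.s<s lt) = consecutive⇒< R tr (y ∷ w) (r ∘ suc) lt

  filter-cong-∈ : ∀ {P Q : U.Pred A 0ℓ} (P? : U.Decidable P) (Q? : U.Decidable Q) xs →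
    (∀ {x} → x ∈List.∈ xs → P x ⇔ Q x) → filter P? xs ≡ filter Q? xs
  filter-cong-∈ P? Q? []       eq = refl
  filter-cong-∈ P? Q? (x ∷ xs) eq with P? x | Q? x
  ... | yes _ | yes _ = cong (x ∷_) (filter-cong-∈ P? Q? xs (eq ∘ there))
  ... | no _  | no _  = filter-cong-∈ P? Q? xs (eq ∘ there)
  ... | yes p | no ¬q = contradiction (Equivalence.to (eq (here refl)) p) ¬q
  ... | no ¬p | yes q = contradiction (Equivalence.from (eq (here refl)) q) ¬p

  length-filter-map : ∀ {B : Set} {P : U.Pred B 0ℓ} (P? : U.Decidable P) (f : A → B) xs →
    length (filter P? (List.map f xs)) ≡ length (filter (P? ∘ f) xs)
  length-filter-map P? f []       = refl
  length-filter-map P? f (x ∷ xs) with P? (f x)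
  ... | yes _ = cong suc (length-filter-map P? f xs)
  ... | no _  = length-filter-map P? f xs

  count-toList : ∀ {P : U.Pred A 0ℓ} (P? : U.Decidable P) {n} (w : Vec A n) →
    Vec.count P? w ≡ length (filter P? (toList w))
  count-toList P? []      = refl
  count-toList P? (x ∷ w) with P? x
  ... | yes _ = cong suc (count-toList P? w)
  ... | no _  = count-toList P? w

-- The image of the first filtered list is free of repetitions and has the same elements as the
-- second.
length-filter-bij : ∀ {A B : Set} {P : U.Pred A 0ℓ} {Q : U.Pred B 0ℓ} (P? : U.Decidable P) (Q? : U.Decidable Q)
  (f : A → B) → (∀ {x y} → f x ≡ f y → x ≡ y) → ∀ {xs ys} → Unique xs → Unique ys →
  (∀ {x} → x ∈List.∈ xs → P x → f x ∈List.∈ ys × Q (f x)) →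
  (∀ {y} → y ∈List.∈ ys → Q y → ∃ λ x → x ∈List.∈ xs × P x × y ≡ f x) →
  length (filter P? xs) ≡ length (filter Q? ys)
length-filter-bij P? Q? f inj {xs} {ys} uxs uys to from = trans
  (sym (List.length-map f (filter P? xs)))
  (same-length (Unique.map⁺ inj (Unique.filter⁺ P? uxs)) (Unique.filter⁺ Q? uys) (mk⇔ to′ from′))
  where
  to′ : ∀ {y} → y ∈List.∈ List.map f (filter P? xs) → y ∈List.∈ filter Q? ys
  to′ y∈ with ∈-map⁻ f y∈
  ... | x , x∈ , refl with ∈-filter⁻ P? {xs = xs} x∈
  ...   | x∈xs , p with to x∈xs p
  ...     | fx∈ys , q = ∈-filter⁺ Q? fx∈ys q

  from′ : ∀ {y} → y ∈List.∈ filter Q? ys → y ∈List.∈ List.map f (filter P? xs)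
  from′ y∈ with ∈-filter⁻ Q? {xs = ys} y∈
  ... | y∈ys , q with from y∈ys q
  ...   | x , x∈xs , p , refl = ∈-map⁺ f (∈-filter⁺ P? x∈xs p)

-- Permutations in one-line notation.

consecutive< : ∀ {n} (j : Fin (pred n)) → pos {n} j Fin.< next {n} j
consecutive< {suc n} j = ℕ.s≤s (ℕ.≤-reflexive (Fin.toℕ-inject₁ j))

Permutation : ∀ {n} → Word n n → Set
Permutation σ = Unique (toList σ)

permutation-injective : ∀ {n} {σ : Word n n} → Permutation σ → ∀ {i j} → lookup σ i ≡ lookup σ j → i ≡ j
permutation-injective {σ = σ} perm {i} {j} eq with Fin.<-cmp i j
... | tri< lt _ _ = contradiction eq (toList-allPairs⁻ σ perm lt)
... | tri≈ _ e _  = e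
... | tri> _ _ gt = contradiction (sym eq) (toList-allPairs⁻ σ perm gt)

injective⇒surjective : ∀ {n} (f : Fin n → Fin n) → (∀ {i j} → f i ≡ f j → i ≡ j) → ∀ x → ∃ λ i → f i ≡ x
injective⇒surjective {suc n} f inj x with Fin.any? (λ i → f i Fin.≟ x)
... | yes hit  = hit
-- If `x` is missed, punching it out of the codomain leaves an injection from `suc n` elements to
-- `n`.
... | no  miss = contradiction
  (Fin.injective⇒≤ {f = λ i → punchOut (avoid i)} λ {i} {j} → inj ∘ Fin.punchOut-injective (avoid i) (avoid j))
  ℕ.1+n≰n
  where
  avoid : ∀ i → x ≢ f i
  avoid i eq = miss (i , sym eq)

permutation-surjective : ∀ {n} (σ : Word n n) → Permutation σ → ∀ x → ∃ λ i → lookup σ i ≡ x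
permutation-surjective σ perm = injective⇒surjective (lookup σ) (permutation-injective {σ = σ} perm)

lookup∈toList : ∀ {A : Set} {n} (w : Vec A n) i → lookup w i ∈List.∈ toList w
lookup∈toList (x ∷ w) zero    = here refl
lookup∈toList (x ∷ w) (suc i) = there (lookup∈toList w i)

permutation-∈ : ∀ {n} (σ : Word n n) → Permutation σ → ∀ x → x ∈List.∈ toList σ
permutation-∈ σ perm x with permutation-surjective σ perm x
... | i , refl = lookup∈toList σ i

permutation-↭ : ∀ {n} (σ τ : Word n n) → Permutation σ → Permutation τ → toList σ ↭ toList τ
permutation-↭ σ τ pσ pτ = ∼bag⇒↭ (unique∧set⇒bag pσ pτ
  (mk⇔ (λ _ → permutation-∈ τ pτ _) (λ _ → permutation-∈ σ pσ _)))

allFin-permutation : ∀ n → Permutation (Vec.allFin n)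
allFin-permutation n = toList-allPairs⁺ (Vec.allFin n) λ {i} {j} lt eq →
  Fin.<⇒≢ lt (trans (sym (Vec.lookup-allFin i)) (trans eq (Vec.lookup-allFin j)))

-- Colourings read along a permutation.

rearrange : ∀ {N n} → Word N n → Word n n → Word N n
rearrange κ σ = Vec.map (lookup κ) σ

-- `σ` and `Vec.allFin n` list the same vertices, and reading `κ` along the latter gives back `κ`.
content-rearrange : ∀ {N n} (κ : Word N n) (σ : Word n n) → Permutation σ → content (rearrange κ σ) ≡ content κ
content-rearrange {n = n} κ σ perm = trans
  (List.tabulate-cong λ c → begin
    occ c (rearrange κ σ) ≡⟨ occ-filter c σ ⟩
    length (filter (c Fin.≟_) (List.map (lookup κ) (toList σ)))
      ≡⟨ ↭-length (filter-↭ (c Fin.≟_) (↭-map⁺ (lookup κ)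
           (permutation-↭ σ (Vec.allFin n) perm (allFin-permutation n)))) ⟩
    length (filter (c Fin.≟_) (List.map (lookup κ) (toList (Vec.allFin n)))) ≡⟨ occ-filter c (Vec.allFin n) ⟨
    occ c (rearrange κ (Vec.allFin n)) ∎)
  (cong content (Vec.map-lookup-allFin κ))
  where
  open ≡-Reasoning

  occ-filter : ∀ c σ → occ c (rearrange κ σ) ≡ length (filter (c Fin.≟_) (List.map (lookup κ) (toList σ)))
  occ-filter c σ = trans (count-toList (c Fin.≟_) (rearrange κ σ))
    (cong (length ∘ filter (c Fin.≟_)) (Vec.toList-map (lookup κ) σ))

rearrange-injective : ∀ {N n} (κ κ′ : Word N n) σ → Permutation σ → rearrange κ σ ≡ rearrange κ′ σ → κ ≡ κ′
rearrange-injective κ κ′ σ perm eq = trans (sym (Vec.tabulate∘lookup κ))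
  (trans (Vec.tabulate-cong agree) (Vec.tabulate∘lookup κ′))
  where
  agree : lookup κ ≗ lookup κ′
  agree x with permutation-surjective σ perm x
  ... | i , refl = trans (sym (Vec.lookup-map i (lookup κ) σ))
    (trans (cong (λ w → lookup w i) eq) (Vec.lookup-map i (lookup κ′) σ))

rearrange-surjective : ∀ {N n} (w : Word N n) σ → Permutation σ → ∃ λ κ → w ≡ rearrange κ σ
rearrange-surjective w σ perm = κ , trans (sym (Vec.tabulate∘lookup w))
  (trans (Vec.tabulate-cong agree) (Vec.tabulate∘lookup (rearrange κ σ)))
  where
  index : ∀ x → ∃ λ i → lookup σ i ≡ x
  index = permutation-surjective σ perm

  -- The composite of `w` with the inverse of `σ`.
  κ : Word _ _
  κ = Vec.tabulate (lookup w ∘ proj₁ ∘ index)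

  agree : lookup w ≗ lookup (rearrange κ σ)
  agree i = sym (trans (Vec.lookup-map i (lookup κ) σ) (trans (Vec.lookup∘tabulate _ (lookup σ i))
    (cong (lookup w) (permutation-injective {σ = σ} perm (proj₂ (index (lookup σ i)))))))

-- Sorting the vertices by colour, rank and label.

keyOrder : ∀ N n → StrictTotalOrder 0ℓ 0ℓ 0ℓ
keyOrder N n = ×-strictTotalOrder (Flip.strictTotalOrder (Fin.<-strictTotalOrder N))
  (×-strictTotalOrder (Flip.strictTotalOrder ℕ.<-strictTotalOrder)
    (Flip.strictTotalOrder (Fin.<-strictTotalOrder n)))

canonicalOrder : ∀ {N n} → Word N n → (Fin n → ℕ) → StrictTotalOrder 0ℓ 0ℓ 0ℓ
canonicalOrder {N} {n} κ r = On.strictTotalOrder (keyOrder N n) (λ x → lookup κ x , r x , x)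

-- All three comparisons are flipped: larger colours come first, then larger ranks, then larger
-- labels. For `r = rank G σ` and two consecutive letters of `σ` of equal colour, what remains to be
-- compared is literally `GDescent`.
Precedes : ∀ {N n} → Word N n → (Fin n → ℕ) → Rel (Fin n) 0ℓ
Precedes κ r = StrictTotalOrder._<_ (canonicalOrder κ r)

SortedBy : ∀ {N n} → Word N n → (Fin n → ℕ) → Word n n → Set
SortedBy κ r σ = AllPairs (Precedes κ r) (toList σ)

WeaklyDecreasing : ∀ {N n} → Word N n → Word n n → Set
WeaklyDecreasing κ σ = AllPairs (λ x y → lookup κ y Fin.≤ lookup κ x) (toList σ)

precedes⇒≥ : ∀ {N n} (κ : Word N n) r {x y} → Precedes κ r x y → lookup κ y Fin.≤ lookup κ x
precedes⇒≥ κ r (inj₁ gt)       = ℕ.<⇒≤ gt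
precedes⇒≥ κ r (inj₂ (eq , _)) = ℕ.≤-reflexive (cong Fin.toℕ (sym eq))

sortedBy⇒weaklyDecreasing : ∀ {N n} (κ : Word N n) r σ → SortedBy κ r σ → WeaklyDecreasing κ σ
sortedBy⇒weaklyDecreasing κ r σ = AllPairs.map (precedes⇒≥ κ r)

sorting : ∀ {N n} (κ : Word N n) r → ∃ λ σ → Permutation σ × SortedBy κ r σ
sorting {n = n} κ r = σ , subst Unique (sym σ≡l) unique , subst (AllPairs _≺_) (sym σ≡l) sorted
  where
  open StrictTotalOrder (canonicalOrder κ r) using () renaming (_<_ to _≺_)

  O : DecTotalOrder 0ℓ 0ℓ 0ℓ
  O = decTotalOrder (canonicalOrder κ r)

  l : List (Fin n)
  l = sort O (allFin n)

  length-l : length l ≡ n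
  length-l = trans (↭-length (sort-↭ O (allFin n))) (List.length-tabulate id)

  σ : Word n n
  σ = Vec.cast length-l (Vec.fromList l)

  σ≡l : toList σ ≡ l
  σ≡l = trans (Vec.toList-cast length-l (Vec.fromList l)) (Vec.toList∘fromList l)

  unique : Unique l
  unique = Unique-resp-↭ (setoid (Fin n)) (↭⇒↭ₛ (↭-sym (sort-↭ O (allFin n)))) (Unique.allFin⁺ n)

  strict : ∀ {x y} → DecTotalOrder._≤_ O x y × x ≢ y → x ≺ y
  strict (inj₁ x≺y           , _)   = x≺y
  -- The label is part of the key, so distinct vertices never tie.
  strict (inj₂ (_ , _ , x≡y) , x≢y) = contradiction x≡y x≢y

  sorted : AllPairs _≺_ l
  sorted = AllPairs.zipWith strict
    (Linked.Linked⇒AllPairs (λ {x} {y} {z} → DecTotalOrder.trans O {x} {y} {z}) (sort-↗ O (allFin n)) , unique)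

abstract
  sortBy : ∀ {N n} → Word N n → (Fin n → ℕ) → Word n n
  sortBy κ r = proj₁ (sorting κ r)

  sortBy-permutation : ∀ {N n} (κ : Word N n) r → Permutation (sortBy κ r)
  sortBy-permutation κ r = proj₁ (proj₂ (sorting κ r))

  sortBy-sorted : ∀ {N n} (κ : Word N n) r → SortedBy κ r (sortBy κ r)
  sortBy-sorted κ r = proj₂ (proj₂ (sorting κ r))

sortedBy-cong : ∀ {N n} (κ : Word N n) {r s} → r ≗ s → ∀ σ → SortedBy κ r σ → SortedBy κ s σ
sortedBy-cong κ {r} {s} r≗s σ = AllPairs.map precedes-cong
  where
  precedes-cong : ∀ {x y} → Precedes κ r x y → Precedes κ s x y
  precedes-cong {x} {y} = subst₂
    (λ k l → StrictTotalOrder._<_ (keyOrder _ _) (lookup κ x , k , x) (lookup κ y , l , y)) (r≗s x) (r≗s y)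

-- By `strict⊆` two strictly sorted listings of all vertices are subwords of each other. The two
-- rank functions are kept apart so that `rank G σ` can be compared with a rank function fixed by
-- `κ`.
sorted-unique : ∀ {N n} (κ : Word N n) {r r′} → r ≗ r′ → ∀ σ τ → Permutation σ → Permutation τ →
                SortedBy κ r σ → SortedBy κ r′ τ → σ ≡ τ
sorted-unique κ {r} {r′} r≗r′ σ τ pσ pτ sσ sτ = trans (sym (Vec.cast-is-id refl σ)) (Vec.toList-injective refl σ τ
  (⊆-antisym (below σ τ pτ sσ sτ′) (below τ σ pσ sτ′ sσ)))
  where
  open StrictTotalOrder (canonicalOrder κ r) using (irrefl; asym)

  sτ′ : SortedBy κ r τ
  sτ′ = sortedBy-cong κ (sym ∘ r≗r′) τ sτ

  below : ∀ σ τ → Permutation τ → SortedBy κ r σ → SortedBy κ r τ → toList σ ⊆ toList τ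
  below σ τ pτ sσ sτ = strict⊆ (Precedes κ r) (λ { {x} refl → irrefl {x} (refl , refl , refl) })
    sσ (AllPairs.map (λ {x} {y} → asym {x} {y}) sτ)
    (All.universal (permutation-∈ τ pτ) (toList σ))

-- The order of appearance in a permutation.

before-irrefl : ∀ {n} {σ : Word n n} → Permutation σ → Irreflexive _≡_ (λ x y → Before x y σ)
before-irrefl {σ = σ} perm refl (p , q , p<q , eq , eq′) =
  Fin.<⇒≢ p<q (permutation-injective {σ = σ} perm (trans eq (sym eq′)))

before-trans : ∀ {n} {σ : Word n n} → Permutation σ → Transitive (λ x y → Before x y σ)
before-trans {σ = σ} perm (p , q , p<q , eq , eq₁) (q′ , s , q′<s , eq₂ , eq₃)
  with permutation-injective {σ = σ} perm (trans eq₁ (sym eq₂))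
... | refl = p , s , Fin.<-trans p<q q′<s , eq , eq₃

before-asym : ∀ {n} {σ : Word n n} → Permutation σ → ∀ {x y} → Before x y σ → ¬ Before y x σ
before-asym perm xy yx = before-irrefl perm refl (before-trans perm xy yx)

-- Ranks as lengths of walks.

module _ {n} (G : Digraph n) where
  open Digraph G

  walk-length≤rank : ∀ {σ x τ} → τ ⊆ toList σ → WalkTo G x τ → length τ ℕ.≤ rank G σ x
  walk-length≤rank {σ} {x} τ⊆σ walk = All.lookup (xs≤max 0 _)
    (∈-map⁺ length (∈-filter⁺ (walkTo? G x) (∈-subwords⁺ τ⊆σ) walk))

  -- Reduces an upper bound on a rank to a bound on every single walk, in the form that `max<v⁺` and
  -- `max≤v⁺` take.
  rank-all : ∀ {σ : Word n n} {x} (P : ℕ → Set) → (∀ {τ} → τ ⊆ toList σ → WalkTo G x τ → P (length τ)) →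
    All P (List.map length (filter (walkTo? G x) (subwords (toList σ))))
  rank-all {σ} {x} P bound = All.map⁺ (All.tabulate λ τ∈ →
    let (τ∈subwords , walk) = ∈-filter⁻ (walkTo? G x) {xs = subwords (toList σ)} τ∈ in
    bound (∈-subwords⁻ (toList σ) τ∈subwords) walk)

  -- Every walk to `x` inside `σ` extends by `y` to a walk that is still a subword of `σ`.
  adjacent⇒rank< : ∀ {σ x y} → Permutation σ → Adjacent x y → Before x y σ → rank G σ x ℕ.< rank G σ y
  adjacent⇒rank< {σ} {x} {y} perm x~y x<y = max<v⁺
    -- The default value 0 of `max` must also lie below the rank of `y`; the one-letter walk `y`
    -- shows that it does.
    (walk-length≤rank {σ} {y} (strict⊆ _≺_ irr ([] ∷ []) inOrder (permutation-∈ σ perm y ∷ [])) (refl , [-]))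
    (rank-all {σ} {x} (ℕ._< rank G σ y) λ {τ} τ⊆σ (last≡ , linked) →
      subst (ℕ._≤ rank G σ y) (length-∷ʳ τ y) (walk-length≤rank {σ} {y}
        -- The letters of `τ` appear in order and the last one, `x`, appears before `y`; by
        -- transitivity the extended word is strictly ordered by appearance.
        (strict⊆ _≺_ irr
          (Linked.Linked⇒AllPairs (before-trans {σ = σ} perm)
            (Linked.++⁺ (Linked.AllPairs⇒Linked (AllPairs-resp-⊆ τ⊆σ increasing)) (connected τ last≡ x<y) [-]))
          inOrder
          (All.universal (permutation-∈ σ perm) (τ List.∷ʳ y)))
        (last-∷ʳ τ y , Linked.++⁺ linked (connected τ last≡ x~y) [-])))
    where
    _≺_ : Rel (Fin n) 0ℓ
    x ≺ y = Before x y σ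

    irr : Irreflexive _≡_ _≺_
    irr = before-irrefl {σ = σ} perm

    increasing : AllPairs _≺_ (toList σ)
    increasing = toList-allPairs⁺ σ λ lt → _ , _ , lt , refl , refl

    inOrder : AllPairs (λ x y → ¬ y ≺ x) (toList σ)
    inOrder = AllPairs.map (before-asym {σ = σ} perm) increasing

    connected : ∀ {R : Rel (Fin n) 0ℓ} τ → List.last τ ≡ just x → R x y → Connected R (List.last τ) (just y)
    connected τ last≡ Rxy rewrite last≡ = just Rxy

  rank-≤ : ∀ {N} (κ : Word N n) → Proper G κ → ∀ σ τ → Permutation τ →
    WeaklyDecreasing κ σ → WeaklyDecreasing κ τ → ∀ x → rank G σ x ℕ.≤ rank G τ x
  rank-≤ κ proper σ τ pτ dσ dτ x = max≤v⁺ ℕ.z≤n (rank-all {σ} {x} (ℕ._≤ rank G τ x)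
    λ {υ} υ⊆σ walk@(_ , linked) → walk-length≤rank {τ} {x} (strict⊆
      -- Colours alone are compared, so `τ` may list a colour class in any order. Along the walk the
      -- drop is strict, since neighbours have different colours.
      (λ x y → lookup κ y Fin.< lookup κ x) (λ { refl → ℕ.<-irrefl refl })
      (Linked.Linked⇒AllPairs (λ gt gt′ → ℕ.<-trans gt′ gt)
        (Linked.zipWith (λ (u~v , ge) → Fin.≤∧≢⇒< ge (proper _ _ u~v ∘ sym))
          (linked , Linked.AllPairs⇒Linked (AllPairs-resp-⊆ υ⊆σ dσ))))
      (AllPairs.map ℕ.≤⇒≯ dτ)
      (All.universal (permutation-∈ τ pτ) υ)) walk)

  rank-cong : ∀ {N} (κ : Word N n) → Proper G κ → ∀ σ τ → Permutation σ → Permutation τ →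
    WeaklyDecreasing κ σ → WeaklyDecreasing κ τ → rank G σ ≗ rank G τ
  rank-cong κ proper σ τ pσ pτ dσ dτ x =
    ℕ.≤-antisym (rank-≤ κ proper σ τ pτ dσ dτ x) (rank-≤ κ proper τ σ pσ dτ dσ x)

  -- Properness, ascents and inversions.

  sortedBy-rank⇒proper : ∀ {N} (κ : Word N n) σ → Permutation σ → SortedBy κ (rank G σ) σ → Proper G κ
  sortedBy-rank⇒proper κ σ perm sorted = proper
    where
    clash : ∀ {p q} → p Fin.< q → Adjacent (lookup σ p) (lookup σ q) → lookup κ (lookup σ p) ≢ lookup κ (lookup σ q)
    clash lt u~v eq with adjacent⇒rank< {σ} perm u~v (_ , _ , lt , refl , refl) | toList-allPairs⁻ σ sorted lt
    ... | _   | inj₁ gt                   = Fin.<⇒≢ gt (sym eq)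
    ... | lt′ | inj₂ (_ , inj₁ gt)        = ℕ.<-asym lt′ gt
    ... | lt′ | inj₂ (_ , inj₂ (eq′ , _)) = ℕ.<⇒≢ lt′ eq′

    proper : Proper G κ
    proper u v u~v κu≡κv with permutation-surjective σ perm u | permutation-surjective σ perm v
    ... | p , refl | q , refl with Fin.<-cmp p q
    ...   | tri< lt _ _   = clash lt u~v κu≡κv
    ...   | tri≈ _ refl _ = [ loopless refl , loopless refl ]′ u~v
    ...   | tri> _ _ gt   = clash gt (swap u~v) (sym κu≡κv)

  -- The endpoint of larger colour appears first, and properness rules out ties on an edge. Hence an
  -- edge is an ascent exactly when its head appears before its tail.
  asc≡inv : ∀ {N} (κ : Word N n) σ → Permutation σ → Proper G κ → WeaklyDecreasing κ σ → asc G κ ≡ inv G σ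
  asc≡inv κ σ perm proper dec = cong length (filter-cong-∈ _ _ edges λ {(u , v)} uv∈ →
    mk⇔ (ascent⇒before u v)
      (λ { (p , q , p<q , refl , refl) → Fin.≤∧≢⇒< (toList-allPairs⁻ σ dec p<q) (proper u v (inj₁ (edge uv∈))) }))
    where
    edge : ∀ {u v} → (u , v) ∈List.∈ edges → E u v
    edge uv∈ = proj₂ (∈-filter⁻ (λ (u , v) → E? u v) {xs = cartesianProduct (allFin n) (allFin n)} uv∈)

    ascent⇒before : ∀ u v → lookup κ u Fin.< lookup κ v → Before v u σ
    ascent⇒before u v lt with permutation-surjective σ perm u | permutation-surjective σ perm v
    ... | p , refl | q , refl with Fin.<-cmp p q
    ...   | tri< p<q _ _  = contradiction (toList-allPairs⁻ σ dec p<q) (ℕ.<⇒≱ lt)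
    ...   | tri≈ _ refl _ = contradiction lt (ℕ.<-irrefl refl)
    ...   | tri> _ _ q<p  = q , p , q<p , refl , refl

  -- Descent sets and sortedness.

  DES-∈ : ∀ σ j → j ∈ DES G σ ⇔ GDescent G σ j
  DES-∈ σ j with gDescent? G σ j in eq
  ... | yes d = mk⇔ (λ _ → d) (λ _ → Vec.lookup⇒[]= j (DES G σ) (trans (Vec.lookup∘tabulate _ j) (cong does eq)))
  ... | no ¬d = mk⇔
    (λ j∈ → contradiction (trans (sym (Vec.[]=⇒lookup j∈)) (trans (Vec.lookup∘tabulate _ j) (cong does eq))) λ ())
    (λ d → contradiction d ¬d)

  -- Transitivity reduces sortedness to consecutive positions. There both sides allow a larger
  -- colour first, and both allow a tie exactly at a `G`-descent.
  fundamental⇔sortedBy : ∀ {N} (κ : Word N n) σ →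
    Fundamental n (∁ (DES G σ)) (rearrange κ σ) ⇔ SortedBy κ (rank G σ) σ
  fundamental⇔sortedBy κ σ = mk⇔ to from
    where
    open StrictTotalOrder (canonicalOrder κ (rank G σ)) using () renaming (trans to ≺-trans)

    e : ∀ i → Fin.toℕ (lookup (rearrange κ σ) i) ≡ Fin.toℕ (lookup κ (lookup σ i))
    e i = cong Fin.toℕ (Vec.lookup-map i (lookup κ) σ)

    to : Fundamental n (∁ (DES G σ)) (rearrange κ σ) → SortedBy κ (rank G σ) σ
    to (weak , strict) =
      toList-allPairs⁺ σ (consecutive⇒< (Precedes κ (rank G σ)) (λ {x} {y} {z} → ≺-trans {x} {y} {z}) σ step)
      where
      step : ∀ j → Precedes κ (rank G σ) (lookup σ (pos j)) (lookup σ (next j))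
      step j with ℕ.m≤n⇒m<n∨m≡n (subst₂ ℕ._≤_ (e (next j)) (e (pos j)) (weak j)) | gDescent? G σ j
      ... | inj₁ lt | _     = inj₁ lt
      ... | inj₂ eq | yes d = inj₂ (Fin.toℕ-injective (sym eq) , d)
      -- Outside `DES G σ` the word drops strictly, so the colours decide.
      ... | inj₂ _  | no ¬d = inj₁ (subst₂ ℕ._<_ (e (next j)) (e (pos j))
        (strict j (x∉p⇒x∈∁p (¬d ∘ Equivalence.to (DES-∈ σ j)))))

    from : SortedBy κ (rank G σ) σ → Fundamental n (∁ (DES G σ)) (rearrange κ σ)
    from sorted =
        (λ j → subst₂ ℕ._≤_ (sym (e (next j))) (sym (e (pos j)))
          (precedes⇒≥ κ (rank G σ) (toList-allPairs⁻ σ sorted (consecutive< j))))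
      , (λ j j∈ → subst₂ ℕ._<_ (sym (e (next j))) (sym (e (pos j))) (strict j j∈))
      where
      strict : ∀ j → j ∈ ∁ (DES G σ) → lookup κ (lookup σ (next j)) Fin.< lookup κ (lookup σ (pos j))
      strict j j∈ with toList-allPairs⁻ σ sorted (consecutive< j)
      ... | inj₁ gt      = gt
      ... | inj₂ (_ , d) = contradiction (Equivalence.from (DES-∈ σ j) d) (x∈∁p⇒x∉p j∈)

  -- All arrangements by weakly decreasing colour have the same ranks, so those
  -- of one of them can be used to break the ties between equal colours.

  abstract
    colourRank : ∀ {N} → Word N n → Fin n → ℕ
    colourRank κ = rank G (sortBy κ (λ _ → 0))

    rank≗colourRank : ∀ {N} (κ : Word N n) → Proper G κ → ∀ σ → Permutation σ → WeaklyDecreasing κ σ →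
      rank G σ ≗ colourRank κ
    rank≗colourRank κ proper σ perm dec = rank-cong κ proper σ (sortBy κ (λ _ → 0))
      perm (sortBy-permutation κ (λ _ → 0)) dec
      (sortedBy⇒weaklyDecreasing κ (λ _ → 0) (sortBy κ (λ _ → 0)) (sortBy-sorted κ (λ _ → 0)))

    standardization : ∀ {N} → Word N n → Word n n
    standardization κ = sortBy κ (colourRank κ)

    standardization-permutation : ∀ {N} (κ : Word N n) → Permutation (standardization κ)
    standardization-permutation κ = sortBy-permutation κ (colourRank κ)

    -- Sortedness by its own ranks looks circular. But sorting by `colourRank κ` already yields a
    -- weakly decreasing arrangement, and its ranks are therefore `colourRank κ` again.
    standardization-sorted : ∀ {N} (κ : Word N n) → Proper G κ →
      SortedBy κ (rank G (standardization κ)) (standardization κ)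
    standardization-sorted κ proper = sortedBy-cong κ
      (λ x → sym (rank≗colourRank κ proper (standardization κ) (standardization-permutation κ)
        (sortedBy⇒weaklyDecreasing κ (colourRank κ) (standardization κ) sorted) x))
      (standardization κ) sorted
      where
      sorted : SortedBy κ (colourRank κ) (standardization κ)
      sorted = sortBy-sorted κ (colourRank κ)

    standardization-unique : ∀ {N} (κ : Word N n) → Proper G κ → ∀ σ → Permutation σ →
      SortedBy κ (rank G σ) σ → σ ≡ standardization κ
    standardization-unique κ proper σ perm sorted = sorted-unique κ
      (rank≗colourRank κ proper σ perm (sortedBy⇒weaklyDecreasing κ (rank G σ) σ sorted))
      σ (standardization κ) perm (standardization-permutation κ) sorted (sortBy-sorted κ (colourRank κ))

  -- The bijection between proper colourings and pairs of a permutation and a word.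

  colour-arrangements : ∀ k a →
    length (filter (withContent? (properWithAsc G k) a) (words (length a) n)) ≡
    length (filter (λ (σ , w) → (k ℕ.≟ inv G σ) ×-dec withContent? (fundamental n (∁ (DES G σ))) a w)
             (cartesianProduct (𝔖 n) (words (length a) n)))
  colour-arrangements k a = length-filter-bij P? R? Ψ Ψ-injective
    (words-unique N n)
    (Unique.cartesianProduct⁺ (Unique.filter⁺ perm? (words-unique n n)) (words-unique N n))
    to from
    where
    N : ℕ
    N = length a

    P : Word N n → Set
    P = WithContent (properWithAsc G k) a

    P? : U.Decidable P
    P? = withContent? (properWithAsc G k) a

    perm? : U.Decidable Permutation
    perm? σ = unique? Fin._≟_ (toList σ)

    R : Word n n × Word N n → Set
    R (σ , w) = k ≡ inv G σ × WithContent (fundamental n (∁ (DES G σ))) a w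

    R? : U.Decidable R
    R? (σ , w) = (k ℕ.≟ inv G σ) ×-dec withContent? (fundamental n (∁ (DES G σ))) a w

    Ψ : Word N n → Word n n × Word N n
    Ψ κ = standardization κ , rearrange κ (standardization κ)

    -- Equal images share their permutation, along which the colouring is read back from the word.
    Ψ-injective : ∀ {κ κ′} → Ψ κ ≡ Ψ κ′ → κ ≡ κ′
    Ψ-injective {κ} {κ′} eq = rearrange-injective κ κ′ (standardization κ) (standardization-permutation κ)
      (trans (cong proj₂ eq) (cong (rearrange κ′) (sym (cong proj₁ eq))))

    to : ∀ {κ} → κ ∈List.∈ words N n → P κ → Ψ κ ∈List.∈ cartesianProduct (𝔖 n) (words N n) × R (Ψ κ)
    to {κ} _ (content≡ , proper , asc≡) =
        ∈-cartesianProduct⁺ (∈-filter⁺ perm? (words-complete σ) perm) (words-complete (rearrange κ σ))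
      , trans (sym asc≡) (asc≡inv κ σ perm proper (sortedBy⇒weaklyDecreasing κ (rank G σ) σ sorted))
      , trans (content-rearrange κ σ perm) content≡
      , Equivalence.from (fundamental⇔sortedBy κ σ) sorted
      where
      σ : Word n n
      σ = standardization κ

      perm : Permutation σ
      perm = standardization-permutation κ

      sorted : SortedBy κ (rank G σ) σ
      sorted = standardization-sorted κ proper

    from : ∀ {p} → p ∈List.∈ cartesianProduct (𝔖 n) (words N n) → R p →
           ∃ λ κ → κ ∈List.∈ words N n × P κ × p ≡ Ψ κ
    from {σ , w} σw∈ (k≡ , content≡ , fund)
      with proj₂ (∈-filter⁻ perm? {xs = words n n} (proj₁ (∈-cartesianProduct⁻ (𝔖 n) (words N n) σw∈)))
    ... | perm with rearrange-surjective w σ perm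
    ...   | κ , refl = κ , words-complete κ ,
      ( trans (sym (content-rearrange κ σ perm)) content≡
      , proper
      , trans (asc≡inv κ σ perm proper (sortedBy⇒weaklyDecreasing κ (rank G σ) σ sorted)) (sym k≡)) ,
      -- The word is already `rearrange κ σ`, so identifying `σ` identifies the pair.
      cong (λ τ → τ , rearrange κ τ) (standardization-unique κ proper σ perm sorted)
      where
      sorted : SortedBy κ (rank G σ) σ
      sorted = Equivalence.to (fundamental⇔sortedBy κ σ) fund

      proper : Proper G κ
      proper = sortedBy-rank⇒proper κ σ perm sorted

-- Coefficients of sums of fundamentals as counts.

fromℕℚ-+ : ∀ p q → fromℕℚ (p ℕ.+ q) ≡ fromℕℚ p ℚ.+ fromℕℚ q
fromℕℚ-+ zero    q = sym (ℚ.+-identityˡ (fromℕℚ q))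
fromℕℚ-+ (suc p) q = begin
  fromℕℚ (suc (p ℕ.+ q))            ≡⟨ fromℕℚ-suc (p ℕ.+ q) ⟩
  1ℚ ℚ.+ fromℕℚ (p ℕ.+ q)           ≡⟨ cong (1ℚ ℚ.+_) (fromℕℚ-+ p q) ⟩
  1ℚ ℚ.+ (fromℕℚ p ℚ.+ fromℕℚ q)    ≡⟨ ℚ.+-assoc 1ℚ (fromℕℚ p) (fromℕℚ q) ⟨
  (1ℚ ℚ.+ fromℕℚ p) ℚ.+ fromℕℚ q    ≡⟨ cong (ℚ._+ fromℕℚ q) (fromℕℚ-suc p) ⟨
  fromℕℚ (suc p) ℚ.+ fromℕℚ q       ∎
  where open ≡-Reasoning

module _ {A : Set} n (S : A → Subset (pred n)) (m : A → ℕ) where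

  -- Each coefficient of a fundamental counts words, so the summand of `x` counts the pairs in its
  -- row of the product: all admissible words if `k ≡ m x`, none otherwise.
  coeff-∑ₜ : ∀ k a xs → coeff (coeffₜ (∑ₜ xs (λ x → F n (S x) ·t^ m x)) k) a ≡
    fromℕℚ (length (filter (λ (x , w) → (k ℕ.≟ m x) ×-dec withContent? (fundamental n (S x)) a w)
                     (cartesianProduct xs (words (length a) n))))
  coeff-∑ₜ k a []       = refl
  coeff-∑ₜ k a (x ∷ xs) = begin
    coeff (coeffₜ (F n (S x) ·t^ m x) k) a ℚ.+ coeff (coeffₜ (∑ₜ xs (λ x → F n (S x) ·t^ m x)) k) a
      ≡⟨ cong₂ ℚ._+_ term (coeff-∑ₜ k a xs) ⟩
    fromℕℚ (count row) ℚ.+ fromℕℚ (count rest)    ≡⟨ fromℕℚ-+ (count row) (count rest) ⟨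
    fromℕℚ (count row ℕ.+ count rest)
      ≡⟨ cong fromℕℚ (trans (sym (List.length-++ (filter P? row))) (cong length (sym (List.filter-++ P? row rest)))) ⟩
    fromℕℚ (count (row ++ rest))                  ∎
    where
    open ≡-Reasoning
    W = words (length a) n

    P? : U.Decidable (λ ((x , w) : A × Word (length a) n) → k ≡ m x × WithContent (fundamental n (S x)) a w)
    P? (x , w) = (k ℕ.≟ m x) ×-dec withContent? (fundamental n (S x)) a w

    row rest : List (A × Word (length a) n)
    row  = List.map (x ,_) W
    rest = cartesianProduct xs W

    count : List (A × Word (length a) n) → ℕ
    count = length ∘ filter P?

    term : coeff (coeffₜ (F n (S x) ·t^ m x) k) a ≡ fromℕℚ (count row)
    term = trans (lemma (k ℕ.≟ m x)) (cong fromℕℚ (sym (length-filter-map P? (x ,_) W)))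
      where
      lemma : (d : Dec (k ≡ m x)) → coeff (if does (k ℕ.≟ m x) then F n (S x) else 0Q) a ≡
              fromℕℚ (length (filter (P? ∘ (x ,_)) W))
      lemma (yes k≡) = trans
        (cong (λ b → coeff (if b then F n (S x) else 0Q) a) (dec-true (k ℕ.≟ m x) k≡))
        (cong (fromℕℚ ∘ length) (List.filter-≐ _ _ ((k≡ ,_) , proj₂) W))
      lemma (no k≢) = trans
        (cong (λ b → coeff (if b then F n (S x) else 0Q) a) (dec-false (k ℕ.≟ m x) k≢))
        (cong fromℕℚ (sym (filter-empty (P? ∘ (x ,_)) (λ _ → k≢ ∘ proj₁) W)))

X-fundamental : ∀ {n} (G : Digraph n) → X G ≈ₜ ∑ₜ (𝔖 n) (λ σ → F n (∁ (DES G σ)) ·t^ inv G σ)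
X-fundamental {n} G k = mk≈ λ a →
  trans (cong fromℕℚ (colour-arrangements G k a)) (sym (coeff-∑ₜ n (λ σ → ∁ (DES G σ)) (inv G) k a (𝔖 n)))

-- Applying `ω`, which removes the complements.

module _ {ω : QSym → QSym} (isOmega : IsOmega ω) where
  open IsOmega isOmega
  open IsLeftModuleHomomorphism isLinear

  ω-F∁ : ∀ n (S : Subset (pred n)) → ω (F n (∁ S)) ≈Q F n S
  ω-F∁ n S = mk≈ λ a → trans (coeff-≡ (ω-F n (∁ S)) a)
    (cong (λ T → coeff (F n T) a) (¬-involutive (∪-∩-booleanAlgebra (pred n)) S))

  -- The conditional is the shape of a coefficient of `F n (∁ S) ·t^ m`, with its test replaced by
  -- an arbitrary Boolean.
  ω-if : ∀ n (S : Subset (pred n)) b → ω (if b then F n (∁ S) else 0Q) ≈Q (if b then F n S else 0Q)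
  ω-if n S true  = ω-F∁ n S
  ω-if n S false = 0ᴹ-homo

  ω-∑ₜ : ∀ {A : Set} n (S : A → Subset (pred n)) (m : A → ℕ) xs →
    extend ω isLinear (∑ₜ xs (λ x → F n (∁ (S x)) ·t^ m x)) ≈ₜ ∑ₜ xs (λ x → F n (S x) ·t^ m x)
  ω-∑ₜ n S m []       k = 0ᴹ-homo
  ω-∑ₜ n S m (x ∷ xs) k = mk≈ λ a → trans
    (coeff-≡ (+ᴹ-homo (coeffₜ (F n (∁ (S x)) ·t^ m x) k) (coeffₜ (∑ₜ xs (λ x → F n (∁ (S x)) ·t^ m x)) k)) a)
    (cong₂ ℚ._+_ (coeff-≡ (ω-if n (S x) (does (k ℕ.≟ m x))) a) (coeff-≡ (ω-∑ₜ n S m xs k) a))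

  ω-expansion : ∀ {A : Set} n (S : A → Subset (pred n)) (m : A → ℕ) xs p →
    p ≈ₜ ∑ₜ xs (λ x → F n (∁ (S x)) ·t^ m x) → extend ω isLinear p ≈ₜ ∑ₜ xs (λ x → F n (S x) ·t^ m x)
  ω-expansion n S m xs p p≈ k = mk≈ λ a → trans (coeff-≡ (⟦⟧-cong (p≈ k)) a) (coeff-≡ (ω-∑ₜ n S m xs k) a)

theorem4 : (n : ℕ) → n ≥ 1 → (G : Digraph n) →
    (ω : QSym → QSym) (isOmega : IsOmega ω) →
    extend ω (IsOmega.isLinear isOmega) (X G)
    ≈ₜ ∑ₜ (𝔖 n) (λ σ → F n (DES G σ) ·t^ inv G σ)
theorem4 n _ G ω isOmega = ω-expansion isOmega n (DES G) (inv G) (𝔖 n) (X G) (X-fundamental G)
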